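{- (1) There is a constant $c>0$ such that for all integers $m\ge 3$ and $r\ge 3$, $\mathrm{ER}(m,3,r)\le c\cdot m\cdot \frac{r^3}{\log r}$. (2) There is a constant $c>0$ such that for all integers $\ell\ge 3$ and $r\ge 3$, $\mathrm{ER}(3,\ell,r)\le \left(\frac{c\, r^3}{\log r}\right)^{\ell-2}$. (3) There is a constant $c>0$ such that for every integer $r\ge 3$, $\mathrm{ER}(4,4,r)\le \frac{c\, r^7}{(\log r)^2}$.
   Context: An edge-coloring of $K_n$ is any map $\chi:E(K_n)\to\omega$ (arbitrarily many colors allowed). A clique is monochromatic if all its edges have the same color, and rainbow if all its edges have pairwise distinct colors. A coloring of a clique $K_s$ is lexical if there is an ordering $v_1,\dots,v_s$ of its vertices such that for $i<j$ and $i'<j'$, $\chi(v_iv_j)=\chi(v_{i'}v_{j'})$ if and only if $i=i'$ (two edges have the same color if and only if they have the same lower endpoint). $\mathrm{ER}(m,\ell,r)$ is the minimum $n$ such that every edge-coloring $\chi:E(K_n)\to\omega$ contains a monochromatic $K_m$, a lexical $K_\ell$, or a rainbow $K_r$. -}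

module Defs where

open import Data.Nat using (ℕ; _≤_; _<_)
open import Data.Fin using (Fin; _<?_)
open import Data.Fin.Properties using ()
open import Data.Product using (Σ; _×_; ∃)
open import Relation.Nullary using (yes; no)
open import Relation.Binary.PropositionalEquality using (_≡_)
open import Function.Definitions using (Injective)
open import Data.Sum using (_⊎_)
open import Function.Bundles using (_⇔_)

-- An edge-colouring of K_n with colours in ω = ℕ.  We use a function
-- Fin n → Fin n → ℕ and read the colour of the edge {u,v} (u ≠ v) as
-- χ u v when u < v and χ v u otherwise; so only the values χ u v with
-- u < v matter, and every map on unordered pairs arises this way.
Coloring : ℕ → Set
Coloring n = Fin n → Fin n → ℕ

edgeCol : ∀ {n} → Coloring n → Fin n → Fin n → ℕ
edgeCol χ u v with u <? v
... | yes _ = χ u v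
... | no  _ = χ v u

-- A copy of K_s in K_n: an injective map f : Fin s → Fin n.
-- The order of Fin s gives the vertex ordering v_1,…,v_s = f 0,…,f (s-1).
Embedding : ℕ → ℕ → Set
Embedding s n = Σ (Fin s → Fin n) λ f → Injective _≡_ _≡_ f

module _ {n s : ℕ} (χ : Coloring n) (f : Fin s → Fin n) where
  col : Fin s → Fin s → ℕ
  col i j = edgeCol χ (f i) (f j)

  Monochromatic : Set
  Monochromatic = ∀ i j i′ j′ → i Data.Fin.< j → i′ Data.Fin.< j′ →
                  col i j ≡ col i′ j′

  Rainbow : Set
  Rainbow = ∀ i j i′ j′ → i Data.Fin.< j → i′ Data.Fin.< j′ →
            col i j ≡ col i′ j′ → (i ≡ i′ × j ≡ j′)

  Lexical : Set
  Lexical = ∀ i j i′ j′ → i Data.Fin.< j → i′ Data.Fin.< j′ →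
            (col i j ≡ col i′ j′) ⇔ (i ≡ i′)

Arrows : ℕ → ℕ → ℕ → ℕ → Set
Arrows n m ℓ r = (χ : Coloring n) →
     (Σ (Embedding m n) λ e → Monochromatic χ (Σ.proj₁ e))
   ⊎ (Σ (Embedding ℓ n) λ e → Lexical χ (Σ.proj₁ e))
   ⊎ (Σ (Embedding r n) λ e → Rainbow χ (Σ.proj₁ e))

-- ER(m,ℓ,r) ≤ B  (B given as the real number N / D with D > 0):
-- the least n with Arrows n m ℓ r exists and is ≤ N / D, i.e. there is
-- some n with Arrows n m ℓ r and n * D ≤ N.
ER≤[_/_] : ℕ → ℕ → ℕ → ℕ → ℕ → Set
ER≤[ N / D ] m ℓ r = ∃ λ n → Arrows n m ℓ r × (Data.Nat._*_ n D ≤ N)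

{-# OPTIONS --safe #-}
-- All three bounds rest on one fact: if every vertex of a coloured K_n has at
-- most d neighbours in each colour and n ≥ C d r³ / log r, then there is a
-- rainbow K_r. The 4-sets carrying two disjoint edges of one colour form a
-- hypergraph of codegree at most 3d. Following Shearer and Alon, draw W from the
-- hard-core measure on its independent sets of size at most R = 3r. Suppose |W| < R
-- and let v be a vertex. Remove vertices of W until v can be added, leaving U; each
-- removed vertex is a blocker, i.e. it can be added to U but then completes an edge
-- with v. If U has few blockers, the sets W leading to U weigh little more than
-- U, so v can be added with not too small a probability; summed over v this costs
-- at most the expectation of |W|. If U has many blockers, then so has W, up to
-- the effect of short cycles in the hypergraph, and the expected number of
-- triples of W that block v is of order log r; but a triple blocks at most 3d
-- vertices. For suitable parameters this makes |W| = R likely, and deleting the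
-- few pairs of adjacent edges of one colour leaves a rainbow clique.
--
-- A colour neighbourhood of more than m vertices contains a monochromatic K_m
-- or a lexical K₃, which gives (1). For (2), induct on ℓ inside a colour
-- neighbourhood. For (3), a colour neighbourhood of z without the forbidden
-- K₄'s has degree O(r³ / log r) in that colour, by (1), and degree at most 5 in
-- every other colour, so a greedy rainbow K_r exists once it has order r⁴ / log r.

module Submission where

open import Defs
open import Level using (Level)
open import Data.Bool using (Bool; true; false; if_then_else_)
open import Data.Empty using (⊥; ⊥-elim)
open import Data.Fin as Fin using (Fin; zero; suc)
open import Data.Fin.Properties as Finₚ using (_≟_; any?; all?; inject≤-injective)
open import Data.Fin.Subset as Subset using (Subset; inside; outside; _∈_; _∉_; _⊆_; ∣_∣)
open import Data.Fin.Subset.Properties using (_∈?_; _⊆?_; ∉⊥)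
open import Data.List as List
  using (List; []; _∷_; _++_; map; length; filter; concatMap; allFin; cartesianProduct)
open import Data.List.Membership.Propositional using (lose) renaming (_∈_ to _∈ˡ_; _∉_ to _∉ˡ_)
open import Data.List.Membership.Propositional.Properties
  using (∈-allFin; ∈-filter⁺; ∈-filter⁻; ∈-++⁺ˡ; ∈-++⁺ʳ; ∈-++⁻; ∈-concatMap⁺; ∈-∃++; ∈-map⁺; ∈-lookup)
import Data.List.Membership.DecPropositional as DecMembership
open import Data.List.Properties
  using (length-++; length-++-sucʳ; length-map; length-filter; length-tabulate; map-tabulate)
open import Data.List.Relation.Unary.All as All using ([]; _∷_)
open import Data.List.Relation.Unary.AllPairs using ([]; _∷_)
open import Data.List.Relation.Unary.Any using (here; there)
open import Data.List.Relation.Unary.Unique.Propositional using (Unique)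
open import Data.List.Relation.Unary.Unique.Propositional.Properties
  using (allFin⁺; filter⁺; cartesianProduct⁺)
open import Data.Nat hiding (_≟_; _/_; _%_)
import Data.Nat.DivMod as DivMod
open import Data.Nat.Logarithm using (⌊log₂_⌋; ⌊log₂⌋-mono-≤)
open import Data.Nat.Logarithm.Core using (⌊log2⌋)
open import Data.Nat.Properties renaming (_≟_ to _ℕ≟_)
open import Data.Nat.Tactic.RingSolver using (solve-∀)
open import Data.Product using (Σ; ∃; ∃-syntax; _×_; _,_; proj₁; proj₂)
open import Data.Product.Properties using (≡-dec)
open import Data.Sum using (_⊎_; inj₁; inj₂; [_,_]′)
open import Data.Vec as Vec using ([]; _∷_; here; there)
open import Data.Vec.Properties using (lookup⇒[]=; lookup∘tabulate)
open import Function using (_∘_; id; case_of_)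
open import Function.Bundles using (mk⇔; module Equivalence)
open import Induction.WellFounded using (Acc; acc)
open import Relation.Binary.PropositionalEquality
open import Relation.Nullary using (Dec; yes; no; ¬_; does; contradiction)
open import Relation.Nullary.Decidable
  using (_×-dec_; _⊎-dec_; _→-dec_; ¬?; decidable-stable; dec-true; True; toWitness)
open import Relation.Unary using (Pred; Decidable)

private variable
  ℓ ℓ′ : Level
  A A′ : Set
  n : ℕ

-- Finite sums and indicators

∑ : List A → (A → ℕ) → ℕ
∑ []       f = 0
∑ (x ∷ xs) f = f x + ∑ xs f

∑-mono : ∀ (xs : List A) {f g} → (∀ x → f x ≤ g x) → ∑ xs f ≤ ∑ xs g
∑-mono []       f≤g = z≤n
∑-mono (x ∷ xs) f≤g = +-mono-≤ (f≤g x) (∑-mono xs f≤g)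

∑-cong : ∀ (xs : List A) {f g} → (∀ x → f x ≡ g x) → ∑ xs f ≡ ∑ xs g
∑-cong []       f≡g = refl
∑-cong (x ∷ xs) f≡g = cong₂ _+_ (f≡g x) (∑-cong xs f≡g)

+-interchange : ∀ a b c d → (a + b) + (c + d) ≡ (a + c) + (b + d)
+-interchange = solve-∀

*-comm-middle : ∀ a b c → a * (b * c) ≡ b * (a * c)
*-comm-middle = solve-∀

∑-+ : ∀ (xs : List A) f g → ∑ xs (λ x → f x + g x) ≡ ∑ xs f + ∑ xs g
∑-+ []       f g = refl
∑-+ (x ∷ xs) f g = trans (cong (f x + g x +_) (∑-+ xs f g)) (+-interchange (f x) (g x) _ _)

∑-*ˡ : ∀ k (xs : List A) f → ∑ xs (λ x → k * f x) ≡ k * ∑ xs f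
∑-*ˡ k []       f = sym (*-zeroʳ k)
∑-*ˡ k (x ∷ xs) f = trans (cong (k * f x +_) (∑-*ˡ k xs f)) (sym (*-distribˡ-+ k (f x) _))

∑-0 : ∀ (xs : List A) → ∑ xs (λ _ → 0) ≡ 0
∑-0 []       = refl
∑-0 (x ∷ xs) = ∑-0 xs

∑-swap : ∀ (xs : List A) (ys : List A′) (f : A → A′ → ℕ) →
         ∑ xs (λ x → ∑ ys (f x)) ≡ ∑ ys (λ y → ∑ xs (λ x → f x y))
∑-swap []       ys f = sym (∑-0 ys)
∑-swap (x ∷ xs) ys f = trans (cong (∑ ys (f x) +_) (∑-swap xs ys f)) (sym (∑-+ ys (f x) _))

∑-++ : ∀ (xs ys : List A) f → ∑ (xs ++ ys) f ≡ ∑ xs f + ∑ ys f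
∑-++ []       ys f = refl
∑-++ (x ∷ xs) ys f = trans (cong (f x +_) (∑-++ xs ys f)) (sym (+-assoc (f x) _ _))

∑-map : ∀ (g : A → A′) xs f → ∑ (map g xs) f ≡ ∑ xs (f ∘ g)
∑-map g []       f = refl
∑-map g (x ∷ xs) f = cong (f (g x) +_) (∑-map g xs f)

∑-bound-∈ : ∀ (xs : List A) {f k} → (∀ {x} → x ∈ˡ xs → f x ≤ k) → ∑ xs f ≤ length xs * k
∑-bound-∈ []       f≤k = z≤n
∑-bound-∈ (x ∷ xs) f≤k = +-mono-≤ (f≤k (here refl)) (∑-bound-∈ xs (f≤k ∘ there))

∑-const : ∀ (xs : List A) k → ∑ xs (λ _ → k) ≡ length xs * k
∑-const []       k = refl
∑-const (x ∷ xs) k = cong (k +_) (∑-const xs k)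

∑-∈ : ∀ {xs : List A} {x} f → x ∈ˡ xs → f x ≤ ∑ xs f
∑-∈ f (here refl) = m≤m+n _ _
∑-∈ f (there x∈)  = ≤-trans (∑-∈ f x∈) (m≤n+m _ _)

-- The first-moment principle: it finally turns a comparison of two expectations into a concrete set
-- of vertices.
∑-<⇒∃< : ∀ (xs : List A) {f g} → ∑ xs f < ∑ xs g → ∃ λ x → f x < g x
∑-<⇒∃< []       ()
∑-<⇒∃< (x ∷ xs) {f} {g} ∑f<∑g with f x <? g x
... | yes fx<gx = x , fx<gx
... | no  fx≮gx = ∑-<⇒∃< xs (+-cancelˡ-< (f x) _ _
                    (<-≤-trans ∑f<∑g (+-monoˡ-≤ _ (≮⇒≥ fx≮gx))))

∑-cartesianProduct : ∀ (xs : List A) (ys : List A′) f →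
  ∑ (cartesianProduct xs ys) f ≡ ∑ xs (λ x → ∑ ys (λ y → f (x , y)))
∑-cartesianProduct []       ys f = refl
∑-cartesianProduct (x ∷ xs) ys f =
  trans (∑-++ (map (x ,_) ys) _ f) (cong₂ _+_ (∑-map (x ,_) ys f) (∑-cartesianProduct xs ys f))

∑-allFin-suc : ∀ (f : Fin (suc n) → ℕ) → ∑ (allFin (suc n)) f ≡ f zero + ∑ (allFin n) (f ∘ suc)
∑-allFin-suc {n} f = cong (f zero +_)
  (trans (cong (λ xs → ∑ xs f) (sym (map-tabulate {n = n} id suc))) (∑-map suc (allFin n) f))

𝟙 : {P : Set ℓ} → Dec P → ℕ
𝟙 P? = if does P? then 1 else 0

module _ {P : Set ℓ} where

  𝟙-yes : (P? : Dec P) → P → 𝟙 P? ≡ 1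
  𝟙-yes (yes _) p = refl
  𝟙-yes (no ¬p) p = contradiction p ¬p

  𝟙-≥1 : (P? : Dec P) → P → 1 ≤ 𝟙 P?
  𝟙-≥1 P? p = ≤-reflexive (sym (𝟙-yes P? p))

  𝟙-≤ : (P? : Dec P) {k : ℕ} → (P → 1 ≤ k) → 𝟙 P? ≤ k
  𝟙-≤ (yes p) 1≤k = 1≤k p
  𝟙-≤ (no _)  1≤k = z≤n

  𝟙*-≤ : (P? : Dec P) {a b : ℕ} → (P → a ≤ b) → 𝟙 P? * a ≤ b
  𝟙*-≤ (yes p) {a} a≤b = ≤-trans (≤-reflexive (*-identityˡ a)) (a≤b p)
  𝟙*-≤ (no _)      a≤b = z≤n

  𝟙*-< : (P? : Dec P) {a b : ℕ} → 𝟙 P? * a < 𝟙 P? * b → P × a < b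
  𝟙*-< (yes p) {a} {b} a<b = p , subst₂ _<_ (*-identityˡ a) (*-identityˡ b) a<b
  𝟙*-< (no _)          ()

  𝟙-*-mono : (P? : Dec P) {a b : ℕ} → (P → a ≤ b) → 𝟙 P? * a ≤ 𝟙 P? * b
  𝟙-*-mono (yes p) a≤b = *-monoʳ-≤ 1 (a≤b p)
  𝟙-*-mono (no _)  a≤b = z≤n

  𝟙-complement : (P? : Dec P) → 𝟙 P? + 𝟙 (¬? P?) ≡ 1
  𝟙-complement (yes _) = refl
  𝟙-complement (no _)  = refl

𝟙-mono : {P : Set ℓ} {Q : Set ℓ′} (P? : Dec P) (Q? : Dec Q) → (P → Q) → 𝟙 P? ≤ 𝟙 Q?
𝟙-mono P? Q? P→Q = 𝟙-≤ P? (λ p → ≤-reflexive (sym (𝟙-yes Q? (P→Q p))))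

-- Counting with lists

length-⊆ : ∀ {xs ys : List A} → Unique xs → (∀ {x} → x ∈ˡ xs → x ∈ˡ ys) → length xs ≤ length ys
length-⊆ {xs = []}     _          xs⊆ys = z≤n
length-⊆ {xs = x ∷ xs} (x∉ ∷ uxs) xs⊆ys with ∈-∃++ (xs⊆ys (here refl))
... | as , bs , refl =
  ≤-trans (s≤s (length-⊆ uxs sub)) (≤-reflexive (sym (length-++-sucʳ as x bs)))
  where
  sub : ∀ {y} → y ∈ˡ xs → y ∈ˡ as ++ bs
  sub y∈ with ∈-++⁻ as (xs⊆ys (there y∈))
  ... | inj₁ y∈as         = ∈-++⁺ˡ y∈as
  ... | inj₂ (here refl)  = contradiction refl (All.lookup x∉ y∈)
  ... | inj₂ (there y∈bs) = ∈-++⁺ʳ as y∈bs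

∑𝟙≡length-filter : {P : Pred A ℓ} (P? : Decidable P) (xs : List A) →
                   ∑ xs (λ x → 𝟙 (P? x)) ≡ length (filter P? xs)
∑𝟙≡length-filter P? []       = refl
∑𝟙≡length-filter P? (x ∷ xs) with P? x
... | yes _ = cong suc (∑𝟙≡length-filter P? xs)
... | no  _ = ∑𝟙≡length-filter P? xs

-- Sums of indicators over all pairs or triples of vertices thereby become lengths of explicitly
-- generated lists, where repetitions in `ys` do no harm.
count-≤ : {P : Pred A ℓ} (P? : Decidable P) {xs ys : List A} → Unique xs →
          (∀ x → P x → x ∈ˡ ys) → ∑ xs (λ x → 𝟙 (P? x)) ≤ length ys
count-≤ P? {xs} uxs P⊆ys = ≤-trans (≤-reflexive (∑𝟙≡length-filter P? xs))
  (length-⊆ (filter⁺ P? uxs) (λ x∈ → P⊆ys _ (proj₂ (∈-filter⁻ P? {xs = xs} x∈))))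

infixl 1 _>>=_
_>>=_ : List A → (A → List A′) → List A′
xs >>= f = concatMap f xs

∈-bind : ∀ {xs : List A} {x y} (f : A → List A′) → x ∈ˡ xs → y ∈ˡ f x → y ∈ˡ (xs >>= f)
∈-bind f x∈ y∈ = ∈-concatMap⁺ f (lose x∈ y∈)

length-bind-∈ : ∀ {xs : List A} {m k} (f : A → List A′) → length xs ≤ m →
                (∀ {x} → x ∈ˡ xs → length (f x) ≤ k) → length (xs >>= f) ≤ m * k
length-bind-∈ {xs = xs} {m} {k} f |xs|≤m |f|≤k = ≤-trans (go xs |f|≤k) (*-monoˡ-≤ k |xs|≤m)
  where
  go : ∀ xs → (∀ {x} → x ∈ˡ xs → length (f x) ≤ k) → length (xs >>= f) ≤ length xs * k
  go []       _    = z≤n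
  go (x ∷ xs) |f|≤ = ≤-trans (≤-reflexive (length-++ (f x))) (+-mono-≤ (|f|≤ (here refl)) (go xs (|f|≤ ∘ there)))

length-bind : ∀ {xs : List A} {m k} (f : A → List A′) → length xs ≤ m → (∀ x → length (f x) ≤ k) →
              length (xs >>= f) ≤ m * k
length-bind {xs = xs} f |xs|≤m |f|≤k = length-bind-∈ {xs = xs} f |xs|≤m (λ _ → |f|≤k _)

lookup-injective : ∀ {xs : List A} → Unique xs → ∀ i j → List.lookup xs i ≡ List.lookup xs j → i ≡ j
lookup-injective (x∉ ∷ uxs) zero    zero    eq = refl
lookup-injective (x∉ ∷ uxs) zero    (suc j) eq = contradiction eq (All.lookup x∉ (∈-lookup j))
lookup-injective (x∉ ∷ uxs) (suc i) zero    eq = contradiction (sym eq) (All.lookup x∉ (∈-lookup i))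
lookup-injective (x∉ ∷ uxs) (suc i) (suc j) eq = cong suc (lookup-injective uxs i j eq)

embed : ∀ {k n} {xs : List (Fin n)} → Unique xs → k ≤ length xs →
        Σ (Embedding k n) λ e → ∀ i → proj₁ e i ∈ˡ xs
embed {xs = xs} uxs k≤ =
  ((λ i → List.lookup xs (Fin.inject≤ i k≤)) ,
   λ eq → inject≤-injective k≤ k≤ _ _ (lookup-injective uxs _ _ eq)) ,
  λ i → ∈-lookup (Fin.inject≤ i k≤)

-- Subsets

ins del : Subset n → Fin n → Subset n
ins W x = W Vec.[ x ]≔ inside
del W x = W Vec.[ x ]≔ outside

x∈ins : ∀ (W : Subset n) x → x ∈ ins W x
x∈ins (b ∷ W) zero    = here
x∈ins (b ∷ W) (suc x) = there (x∈ins W x)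

W⊆ins : ∀ (W : Subset n) x → W ⊆ ins W x
W⊆ins (b ∷ W) zero    here      = here
W⊆ins (b ∷ W) zero    (there p) = there p
W⊆ins (b ∷ W) (suc x) here      = here
W⊆ins (b ∷ W) (suc x) (there p) = there (W⊆ins W x p)

∈-ins⁻ : ∀ (W : Subset n) x {y} → y ∈ ins W x → y ≡ x ⊎ y ∈ W
∈-ins⁻ (b ∷ W) zero    here      = inj₁ refl
∈-ins⁻ (b ∷ W) zero    (there p) = inj₂ (there p)
∈-ins⁻ (b ∷ W) (suc x) here      = inj₂ here
∈-ins⁻ (b ∷ W) (suc x) (there p) with ∈-ins⁻ W x p
... | inj₁ refl = inj₁ refl
... | inj₂ q    = inj₂ (there q)

∈-del⁻ : ∀ (W : Subset n) x {y} → y ∈ del W x → y ∈ W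
∈-del⁻ (b ∷ W) zero    (there p) = there p
∈-del⁻ (b ∷ W) (suc x) here      = here
∈-del⁻ (b ∷ W) (suc x) (there p) = there (∈-del⁻ W x p)

∈-del⁺ : ∀ (W : Subset n) x {y} → y ∈ W → y ≢ x → y ∈ del W x
∈-del⁺ (b ∷ W) zero    here      y≢x = contradiction refl y≢x
∈-del⁺ (b ∷ W) zero    (there p) y≢x = there p
∈-del⁺ (b ∷ W) (suc x) here      y≢x = here
∈-del⁺ (b ∷ W) (suc x) (there p) y≢x = there (∈-del⁺ W x p (y≢x ∘ cong suc))

ins-mono : ∀ {U W : Subset n} → U ⊆ W → ∀ x → ins U x ⊆ ins W x
ins-mono {U = U} {W} U⊆W x y∈ with ∈-ins⁻ U x y∈
... | inj₁ refl = x∈ins W x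
... | inj₂ y∈U  = W⊆ins W x (U⊆W y∈U)

elems : Subset n → List (Fin n)
elems {n} W = filter (_∈? W) (allFin n)

size : Subset n → ℕ
size W = length (elems W)

∈-elems⁺ : ∀ (W : Subset n) {x} → x ∈ W → x ∈ˡ elems W
∈-elems⁺ W x∈ = ∈-filter⁺ (_∈? W) (∈-allFin _) x∈

∈-elems⁻ : ∀ (W : Subset n) {x} → x ∈ˡ elems W → x ∈ W
∈-elems⁻ W x∈ = proj₂ (∈-filter⁻ (_∈? W) {xs = allFin _} x∈)

elems-unique : ∀ (W : Subset n) → Unique (elems W)
elems-unique W = filter⁺ (_∈? W) (allFin⁺ _)

size-mono : ∀ {U W : Subset n} → U ⊆ W → size U ≤ size W
size-mono {U = U} {W} U⊆W = length-⊆ (elems-unique U) (∈-elems⁺ W ∘ U⊆W ∘ ∈-elems⁻ U)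

size-ins : ∀ (W : Subset n) x → size (ins W x) ≤ suc (size W)
size-ins W x = length-⊆ (elems-unique (ins W x)) λ y∈ →
  [ here , there ∘ ∈-elems⁺ W ]′ (∈-ins⁻ W x (∈-elems⁻ (ins W x) y∈))

subsets : ∀ n → List (Subset n)
subsets zero    = [] ∷ []
subsets (suc n) = map (outside ∷_) (subsets n) ++ map (inside ∷_) (subsets n)

∈-subsets : ∀ (W : Subset n) → W ∈ˡ subsets n
∈-subsets []                = here refl
∈-subsets {suc n} (outside ∷ W) = ∈-++⁺ˡ (∈-map⁺ (outside ∷_) (∈-subsets W))
∈-subsets {suc n} (inside  ∷ W) = ∈-++⁺ʳ (map (outside ∷_) (subsets n)) (∈-map⁺ (inside ∷_) (∈-subsets W))

∑-subsets-suc : ∀ (f : Subset (suc n) → ℕ) →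
  ∑ (subsets (suc n)) f ≡ ∑ (subsets n) (f ∘ (outside ∷_)) + ∑ (subsets n) (f ∘ (inside ∷_))
∑-subsets-suc {n} f = trans (∑-++ (map (outside ∷_) (subsets n)) _ f)
  (cong₂ _+_ (∑-map _ (subsets n) f) (∑-map _ (subsets n) f))

-- The hard-core weights, scaled by qⁿ to stay in ℕ: the fugacity is 1/q.

module Weights (q : ℕ) where

  weight : Subset n → ℕ
  weight []            = 1
  weight (outside ∷ W) = q * weight W
  weight (inside  ∷ W) = weight W

  weight>0 : 0 < q → ∀ (W : Subset n) → 0 < weight W
  weight>0 q>0 []            = s≤s z≤n
  weight>0 q>0 (outside ∷ W) = *-mono-< {0} q>0 (weight>0 q>0 W)
  weight>0 q>0 (inside  ∷ W) = weight>0 q>0 W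

  -- Not normalised: means and probabilities appear as inequalities between two such sums, one of
  -- them a multiple of a partition function.
  𝔼 : (Subset n → ℕ) → ℕ
  𝔼 {n} f = ∑ (subsets n) (λ W → weight W * f W)

  𝔼-suc : ∀ (f : Subset (suc n) → ℕ) → 𝔼 f ≡ q * 𝔼 (f ∘ (outside ∷_)) + 𝔼 (f ∘ (inside ∷_))
  𝔼-suc {n} f = trans (∑-subsets-suc (λ W → weight W * f W)) (cong (_+ 𝔼 (f ∘ (inside ∷_)))
    (trans (∑-cong (subsets n) (λ W → *-assoc q (weight W) _)) (∑-*ˡ q (subsets n) _)))

  𝔼-mono : ∀ {f g : Subset n → ℕ} → (∀ W → f W ≤ g W) → 𝔼 f ≤ 𝔼 g
  𝔼-mono {n} f≤g = ∑-mono (subsets n) (λ W → *-monoʳ-≤ (weight W) (f≤g W))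

  𝔼-cong : ∀ {f g : Subset n → ℕ} → (∀ W → f W ≡ g W) → 𝔼 f ≡ 𝔼 g
  𝔼-cong {n} f≡g = ∑-cong (subsets n) (λ W → cong (weight W *_) (f≡g W))

  𝔼-+ : ∀ (f g : Subset n → ℕ) → 𝔼 (λ W → f W + g W) ≡ 𝔼 f + 𝔼 g
  𝔼-+ {n} f g = trans (∑-cong (subsets n) (λ W → *-distribˡ-+ (weight W) (f W) (g W))) (∑-+ (subsets n) _ _)

  𝔼-*ˡ : ∀ k (f : Subset n → ℕ) → 𝔼 (λ W → k * f W) ≡ k * 𝔼 f
  𝔼-*ˡ {n} k f = trans (∑-cong (subsets n) (λ W → *-comm-middle (weight W) k (f W))) (∑-*ˡ k (subsets n) _)

  𝔼-∑ : ∀ (xs : List A) (f : A → Subset n → ℕ) → 𝔼 (λ W → ∑ xs (λ x → f x W)) ≡ ∑ xs (λ x → 𝔼 (f x))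
  𝔼-∑ {n = n} xs f = trans (∑-cong (subsets n) (λ W → sym (∑-*ˡ (weight W) xs (λ x → f x W))))
    (∑-swap (subsets n) xs _)

  𝔼-0 : ∀ n → 𝔼 {n} (λ _ → 0) ≡ 0
  𝔼-0 n = trans (∑-cong (subsets n) (λ W → *-zeroʳ (weight W))) (∑-0 (subsets n))

  -- Deleting `x` maps the sets containing it bijectively onto those missing it and multiplies the
  -- weight by `q`.
  𝔼-removal : ∀ (x : Fin n) (f : Subset n → ℕ) →
    q * 𝔼 (λ W → 𝟙 (x ∈? W) * f (del W x)) ≡ 𝔼 (λ W → 𝟙 (¬? (x ∈? W)) * f W)
  𝔼-removal {suc n} zero f = begin
    q * 𝔼 (λ W → 𝟙 (zero ∈? W) * f (del W zero))
      ≡⟨ cong (q *_) (𝔼-suc (λ W → 𝟙 (zero ∈? W) * f (del W zero))) ⟩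
    q * (q * 𝔼 {n} (λ _ → 0) + 𝔼 (λ W → 1 * f (outside ∷ W)))
      ≡⟨ cong (q *_) (cong (_+ 𝔼 (λ W → 1 * f (outside ∷ W))) (trans (cong (q *_) (𝔼-0 n)) (*-zeroʳ q))) ⟩
    q * 𝔼 (λ W → 1 * f (outside ∷ W))
      ≡⟨ sym (+-identityʳ _) ⟩
    q * 𝔼 (λ W → 1 * f (outside ∷ W)) + 0
      ≡⟨ cong (q * 𝔼 (λ W → 1 * f (outside ∷ W)) +_) (sym (𝔼-0 n)) ⟩
    q * 𝔼 (λ W → 1 * f (outside ∷ W)) + 𝔼 {n} (λ _ → 0)
      ≡⟨ sym (𝔼-suc (λ W → 𝟙 (¬? (zero ∈? W)) * f W)) ⟩
    𝔼 (λ W → 𝟙 (¬? (zero ∈? W)) * f W) ∎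
    where open ≡-Reasoning
  𝔼-removal {suc n} (suc x) f = begin
    q * 𝔼 (λ W → 𝟙 (suc x ∈? W) * f (del W (suc x)))
      ≡⟨ cong (q *_) (𝔼-suc (λ W → 𝟙 (suc x ∈? W) * f (del W (suc x)))) ⟩
    q * (q * 𝔼 (λ W → 𝟙 (x ∈? W) * f (outside ∷ del W x)) + 𝔼 (λ W → 𝟙 (x ∈? W) * f (inside ∷ del W x)))
      ≡⟨ *-distribˡ-+ q _ (𝔼 (λ W → 𝟙 (x ∈? W) * f (inside ∷ del W x))) ⟩
    q * (q * 𝔼 (λ W → 𝟙 (x ∈? W) * f (outside ∷ del W x))) + q * 𝔼 (λ W → 𝟙 (x ∈? W) * f (inside ∷ del W x))
      ≡⟨ cong₂ _+_ (cong (q *_) (𝔼-removal x (f ∘ (outside ∷_)))) (𝔼-removal x (f ∘ (inside ∷_))) ⟩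
    q * 𝔼 (λ W → 𝟙 (¬? (x ∈? W)) * f (outside ∷ W)) + 𝔼 (λ W → 𝟙 (¬? (x ∈? W)) * f (inside ∷ W))
      ≡⟨ sym (𝔼-suc (λ W → 𝟙 (¬? (suc x ∈? W)) * f W)) ⟩
    𝔼 (λ W → 𝟙 (¬? (suc x ∈? W)) * f W) ∎
    where open ≡-Reasoning

  𝔼-removal-≤ : ∀ (x : Fin n) {f g : Subset n → ℕ} →
    (∀ W → x ∈ W → g W ≤ f (del W x)) → q * 𝔼 (λ W → 𝟙 (x ∈? W) * g W) ≤ 𝔼 f
  𝔼-removal-≤ x {f} {g} g≤f = begin
    q * 𝔼 (λ W → 𝟙 (x ∈? W) * g W)         ≤⟨ *-monoʳ-≤ q (𝔼-mono (λ W → 𝟙-*-mono (x ∈? W) (g≤f W))) ⟩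
    q * 𝔼 (λ W → 𝟙 (x ∈? W) * f (del W x)) ≡⟨ 𝔼-removal x f ⟩
    𝔼 (λ W → 𝟙 (¬? (x ∈? W)) * f W)        ≤⟨ 𝔼-mono (λ W → 𝟙*-≤ (¬? (x ∈? W)) (λ _ → ≤-refl)) ⟩
    𝔼 f ∎
    where open ≤-Reasoning

  -- The indicator of A ⊆ W ⊆ A ∪ B, given coordinatewise so that its weight can be summed by
  -- recursion.
  between : (A B W : Subset n) → ℕ
  between []            []            []            = 1
  between (inside  ∷ A) (_       ∷ B) (inside  ∷ W) = between A B W
  between (inside  ∷ A) (_       ∷ B) (outside ∷ W) = 0
  between (outside ∷ A) (inside  ∷ B) (_       ∷ W) = between A B W
  between (outside ∷ A) (outside ∷ B) (outside ∷ W) = between A B W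
  between (outside ∷ A) (outside ∷ B) (inside  ∷ W) = 0

  between≥1 : ∀ (A B W : Subset n) → A ⊆ W → (∀ {x} → x ∈ W → x ∉ A → x ∈ B) → 1 ≤ between A B W
  between≥1 []      []      []      A⊆W W⊆A∪B = ≤-refl
  between≥1 (a ∷ A) (b ∷ B) (w ∷ W) A⊆W W⊆A∪B = go a b w A⊆W W⊆A∪B
    where
    unthere : ∀ {n} {x : Fin n} {s : Bool} {S : Subset n} → suc x ∈ (s ∷ S) → x ∈ S
    unthere (there x∈) = x∈
    go : ∀ a b w → (a ∷ A) ⊆ (w ∷ W) → (∀ {x} → x ∈ (w ∷ W) → x ∉ (a ∷ A) → x ∈ (b ∷ B)) →
         1 ≤ between (a ∷ A) (b ∷ B) (w ∷ W)
    go a b w A⊆W W⊆A∪B with between≥1 A B W (unthere ∘ A⊆W ∘ there)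
                               (λ x∈ x∉ → unthere (W⊆A∪B (there x∈) (x∉ ∘ unthere)))
    go true  b     true  A⊆W W⊆A∪B | ih = ih
    go true  b     false A⊆W W⊆A∪B | ih with A⊆W here
    ... | ()
    go false true  w     A⊆W W⊆A∪B | ih = ih
    go false false false A⊆W W⊆A∪B | ih = ih
    go false false true  A⊆W W⊆A∪B | ih with W⊆A∪B here (λ ())
    ... | ()

  -- Each vertex of `B` outside `A` is free and contributes a factor 1 + 1/q to the weight of `A`; a
  -- vertex of `B` inside `A` only adds slack. The powers of `q` clear denominators.
  𝔼-between : ∀ (A B : Subset n) → 𝔼 (between A B) * q ^ ∣ B ∣ ≤ weight A * suc q ^ ∣ B ∣
  𝔼-between []           []      = ≤-refl
  𝔼-between {suc n} (inside ∷ A) (b ∷ B) = begin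
    𝔼 (between (inside ∷ A) (b ∷ B)) * q ^ ∣ b ∷ B ∣
      ≡⟨ cong (_* q ^ ∣ b ∷ B ∣) (trans (𝔼-suc (between (inside ∷ A) (b ∷ B)))
           (cong (_+ 𝔼 (between A B)) (trans (cong (q *_) (𝔼-0 n)) (*-zeroʳ q)))) ⟩
    𝔼 (between A B) * q ^ ∣ b ∷ B ∣
      ≤⟨ scale b ⟩
    weight A * suc q ^ ∣ b ∷ B ∣ ∎
    where
    open ≤-Reasoning
    scale : ∀ b → 𝔼 (between A B) * q ^ ∣ b ∷ B ∣ ≤ weight A * suc q ^ ∣ b ∷ B ∣
    scale false = 𝔼-between A B
    scale true  = begin
      𝔼 (between A B) * (q * q ^ ∣ B ∣)     ≡⟨ *-comm-middle (𝔼 (between A B)) q _ ⟩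
      q * (𝔼 (between A B) * q ^ ∣ B ∣)     ≤⟨ *-mono-≤ (n≤1+n q) (𝔼-between A B) ⟩
      suc q * (weight A * suc q ^ ∣ B ∣)    ≡⟨ *-comm-middle (suc q) (weight A) _ ⟩
      weight A * (suc q * suc q ^ ∣ B ∣)    ∎
  𝔼-between {suc n} (outside ∷ A) (outside ∷ B) = begin
    𝔼 (between (outside ∷ A) (outside ∷ B)) * q ^ ∣ B ∣
      ≡⟨ cong (_* q ^ ∣ B ∣) (trans (𝔼-suc (between (outside ∷ A) (outside ∷ B)))
           (trans (cong (q * 𝔼 (between A B) +_) (𝔼-0 n)) (+-identityʳ _))) ⟩
    q * 𝔼 (between A B) * q ^ ∣ B ∣    ≡⟨ *-assoc q _ _ ⟩
    q * (𝔼 (between A B) * q ^ ∣ B ∣)  ≤⟨ *-monoʳ-≤ q (𝔼-between A B) ⟩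
    q * (weight A * suc q ^ ∣ B ∣)     ≡⟨ sym (*-assoc q _ _) ⟩
    q * weight A * suc q ^ ∣ B ∣       ∎
    where open ≤-Reasoning
  𝔼-between (outside ∷ A) (inside ∷ B) = begin
    𝔼 (between (outside ∷ A) (inside ∷ B)) * (q * q ^ ∣ B ∣)
      ≡⟨ cong (_* (q * q ^ ∣ B ∣)) (trans (𝔼-suc (between (outside ∷ A) (inside ∷ B)))
           (+-comm (q * 𝔼 (between A B)) (𝔼 (between A B)))) ⟩
    suc q * 𝔼 (between A B) * (q * q ^ ∣ B ∣)    ≡⟨ regroup (suc q) (𝔼 (between A B)) q (q ^ ∣ B ∣) ⟩
    suc q * q * (𝔼 (between A B) * q ^ ∣ B ∣)    ≤⟨ *-monoʳ-≤ (suc q * q) (𝔼-between A B) ⟩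
    suc q * q * (weight A * suc q ^ ∣ B ∣)       ≡⟨ regroup′ (suc q) q (weight A) (suc q ^ ∣ B ∣) ⟩
    q * weight A * (suc q * suc q ^ ∣ B ∣)       ∎
    where
    open ≤-Reasoning
    regroup : ∀ a b c d → a * b * (c * d) ≡ a * c * (b * d)
    regroup = solve-∀
    regroup′ : ∀ a b c d → a * b * (c * d) ≡ b * c * (a * d)
    regroup′ = solve-∀

  module Restricted {n : ℕ} {P : Pred (Subset n) ℓ} (P? : Decidable P) where

    𝔼ₚ : (Subset n → ℕ) → ℕ
    𝔼ₚ f = 𝔼 (λ W → 𝟙 (P? W) * f W)

    𝔼ₚ-mono : ∀ {f g} → (∀ W → P W → f W ≤ g W) → 𝔼ₚ f ≤ 𝔼ₚ g
    𝔼ₚ-mono f≤g = 𝔼-mono (λ W → 𝟙-*-mono (P? W) (f≤g W))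

    𝔼ₚ-+ : ∀ f g → 𝔼ₚ (λ W → f W + g W) ≡ 𝔼ₚ f + 𝔼ₚ g
    𝔼ₚ-+ f g = trans (𝔼-cong (λ W → *-distribˡ-+ (𝟙 (P? W)) (f W) (g W)))
      (𝔼-+ (λ W → 𝟙 (P? W) * f W) (λ W → 𝟙 (P? W) * g W))

    𝔼ₚ-*ˡ : ∀ k f → 𝔼ₚ (λ W → k * f W) ≡ k * 𝔼ₚ f
    𝔼ₚ-*ˡ k f = trans (𝔼-cong (λ W → *-comm-middle (𝟙 (P? W)) k (f W))) (𝔼-*ˡ k (λ W → 𝟙 (P? W) * f W))

    𝔼ₚ-∑ : ∀ {A : Set} (xs : List A) (f : A → Subset n → ℕ) →
           𝔼ₚ (λ W → ∑ xs (λ x → f x W)) ≡ ∑ xs (λ x → 𝔼ₚ (f x))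
    𝔼ₚ-∑ xs f = trans (𝔼-cong (λ W → sym (∑-*ˡ (𝟙 (P? W)) xs (λ x → f x W))))
      (𝔼-∑ xs (λ x W → 𝟙 (P? W) * f x W))

    -- The partition function of the restricted measure.
    total : ℕ
    total = 𝔼ₚ (λ _ → 1)

    𝔼ₚ-bound : ∀ {f} k → (∀ W → P W → f W ≤ k) → 𝔼ₚ f ≤ k * total
    𝔼ₚ-bound {f} k f≤k = ≤-trans
      (𝔼ₚ-mono (λ W p → ≤-trans (f≤k W p) (≤-reflexive (sym (*-identityʳ k)))))
      (≤-reflexive (𝔼ₚ-*ˡ k (λ _ → 1)))

∣tabulate∣ : ∀ {P : Fin n → Set} (P? : ∀ x → Dec (P x)) →
             ∣ Vec.tabulate (does ∘ P?) ∣ ≡ ∑ (allFin n) (𝟙 ∘ P?)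
∣tabulate∣ {zero}  P? = refl
∣tabulate∣ {suc n} P? = trans (head (P? zero)) (sym (∑-allFin-suc (𝟙 ∘ P?)))
  where
  head : ∀ {Q : Set} (Q? : Dec Q) →
         ∣ does Q? ∷ Vec.tabulate (does ∘ P? ∘ suc) ∣ ≡ 𝟙 Q? + ∑ (allFin n) (𝟙 ∘ P? ∘ suc)
  head (yes _) = cong suc (∣tabulate∣ (P? ∘ suc))
  head (no _)  = ∣tabulate∣ (P? ∘ suc)

∈-tabulate⁺ : ∀ {P : Fin n → Set} (P? : ∀ x → Dec (P x)) {x} → P x → x ∈ Vec.tabulate (does ∘ P?)
∈-tabulate⁺ P? {x} p = lookup⇒[]= x _ (trans (lookup∘tabulate (does ∘ P?) x) (dec-true (P? x) p))

-- The hard-core measure on independent sets of a 4-uniform hypergraph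

-- ext x y z lists the vertices completing x, y, z to an edge: H has codegree at most D.
record Hypergraph (n D : ℕ) : Set₁ where
  field
    H            : Fin n → Fin n → Fin n → Fin n → Set
    H?           : ∀ x y z w → Dec (H x y z w)
    swap₁₂       : ∀ {x y z w} → H x y z w → H y x z w
    swap₂₃       : ∀ {x y z w} → H x y z w → H x z y w
    swap₃₄       : ∀ {x y z w} → H x y z w → H x y w z
    distinct₁₂   : ∀ {x y z w} → H x y z w → x ≢ y
    ext          : Fin n → Fin n → Fin n → List (Fin n)
    ext-complete : ∀ {x y z w} → H x y z w → w ∈ˡ ext x y z
    ext-length   : ∀ x y z → length (ext x y z) ≤ D

module HardCore {n D : ℕ} (G : Hypergraph n D) (R q : ℕ) where

  open Hypergraph G
  open Weights q

  V : List (Fin n)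
  V = allFin n

  swap₁₃ : ∀ {x y z w} → H x y z w → H z y x w
  swap₁₃ = swap₁₂ ∘ swap₂₃ ∘ swap₁₂

  swap₁₄ : ∀ {x y z w} → H x y z w → H w y z x
  swap₁₄ = swap₁₃ ∘ swap₃₄ ∘ swap₁₃

  swap₂₄ : ∀ {x y z w} → H x y z w → H x w z y
  swap₂₄ = swap₂₃ ∘ swap₃₄ ∘ swap₂₃

  rotate : ∀ {x y z w} → H x y z w → H y z w x
  rotate = swap₃₄ ∘ swap₂₃ ∘ swap₁₂

  distinct₁₃ : ∀ {x y z w} → H x y z w → x ≢ z
  distinct₁₃ = distinct₁₂ ∘ swap₂₃

  distinct₁₄ : ∀ {x y z w} → H x y z w → x ≢ w
  distinct₁₄ = distinct₁₂ ∘ swap₂₄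

  distinct₂₃ : ∀ {x y z w} → H x y z w → y ≢ z
  distinct₂₃ = distinct₁₃ ∘ swap₁₂

  distinct₂₄ : ∀ {x y z w} → H x y z w → y ≢ w
  distinct₂₄ = distinct₁₄ ∘ swap₁₂

  distinct₃₄ : ∀ {x y z w} → H x y z w → z ≢ w
  distinct₃₄ = distinct₂₄ ∘ swap₂₃

  HasEdge : Subset n → Set
  HasEdge W = ∃[ x ] ∃[ y ] ∃[ z ] ∃[ w ] (x ∈ W × y ∈ W × z ∈ W × w ∈ W × H x y z w)

  abstract
    hasEdge? : ∀ W → Dec (HasEdge W)
    hasEdge? W = any? λ x → any? λ y → any? λ z → any? λ w →
      (x ∈? W) ×-dec (y ∈? W) ×-dec (z ∈? W) ×-dec (w ∈? W) ×-dec H? x y z w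

  hasEdge-mono : ∀ {U W} → U ⊆ W → HasEdge U → HasEdge W
  hasEdge-mono U⊆W (x , y , z , w , x∈ , y∈ , z∈ , w∈ , e) =
    x , y , z , w , U⊆W x∈ , U⊆W y∈ , U⊆W z∈ , U⊆W w∈ , e

  Indep : Subset n → Set
  Indep W = ¬ HasEdge W

  indep? : ∀ W → Dec (Indep W)
  indep? W = ¬? (hasEdge? W)

  indep-anti : ∀ {U W} → U ⊆ W → Indep W → Indep U
  indep-anti U⊆W iW eU = iW (hasEdge-mono U⊆W eU)

  ∈-ins-≢ : ∀ (W : Subset n) x {y} → y ∈ ins W x → y ≢ x → y ∈ W
  ∈-ins-≢ W x y∈ y≢x with ∈-ins⁻ W x y∈
  ... | inj₁ y≡x = contradiction y≡x y≢x
  ... | inj₂ y∈W = y∈W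

  -- As `W` is independent, the edge must use `v`, and the symmetry of `H` moves `v` to the front;
  -- distinctness puts the other vertices in `W`.
  edge-through : ∀ {W v} → Indep W → HasEdge (ins W v) →
    ∃[ x ] ∃[ y ] ∃[ z ] (x ∈ W × y ∈ W × z ∈ W × H v x y z)
  edge-through {W} {v} iW (x , y , z , w , x∈ , y∈ , z∈ , w∈ , e) =
    go (∈-ins⁻ W v x∈) (∈-ins⁻ W v y∈) (∈-ins⁻ W v z∈) (∈-ins⁻ W v w∈)
    where
    at : ∀ {x y z} → x ∈ ins W v → y ∈ ins W v → z ∈ ins W v → H v x y z →
         ∃[ x ] ∃[ y ] ∃[ z ] (x ∈ W × y ∈ W × z ∈ W × H v x y z)
    at x∈ y∈ z∈ e = _ , _ , _ , ∈-ins-≢ W v x∈ (≢-sym (distinct₁₂ e)) ,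
      ∈-ins-≢ W v y∈ (≢-sym (distinct₁₃ e)) , ∈-ins-≢ W v z∈ (≢-sym (distinct₁₄ e)) , e
    go : x ≡ v ⊎ x ∈ W → y ≡ v ⊎ y ∈ W → z ≡ v ⊎ z ∈ W → w ≡ v ⊎ w ∈ W →
         ∃[ x ] ∃[ y ] ∃[ z ] (x ∈ W × y ∈ W × z ∈ W × H v x y z)
    go (inj₁ refl) _ _ _ = at y∈ z∈ w∈ e
    go _ (inj₁ refl) _ _ = at x∈ z∈ w∈ (swap₁₂ e)
    go _ _ (inj₁ refl) _ = at y∈ x∈ w∈ (swap₁₃ e)
    go _ _ _ (inj₁ refl) = at y∈ z∈ x∈ (swap₁₄ e)
    go (inj₂ x∈) (inj₂ y∈) (inj₂ z∈) (inj₂ w∈) = contradiction (x , y , z , w , x∈ , y∈ , z∈ , w∈ , e) iW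

  EdgeInto : Fin n → Fin n → Subset n → Set
  EdgeInto v c W = ∃[ a ] ∃[ b ] (a ∈ W × b ∈ W × H v c a b)

  abstract
    edgeInto? : ∀ v c W → Dec (EdgeInto v c W)
    edgeInto? v c W = any? λ a → any? λ b → (a ∈? W) ×-dec (b ∈? W) ×-dec H? v c a b

  edgeInto-mono : ∀ {v c U W} → U ⊆ W → EdgeInto v c U → EdgeInto v c W
  edgeInto-mono U⊆W (a , b , a∈ , b∈ , e) = a , b , U⊆W a∈ , U⊆W b∈ , e

  -- The edge uses `v` because W + c is independent, and uses `c` because W + v is.
  edgeInto : ∀ {W v c} → Indep (ins W c) → Indep (ins W v) → HasEdge (ins (ins W c) v) → EdgeInto v c W
  edgeInto {W} {v} {c} ic iv e with edge-through ic e
  ... | x , y , z , x∈ , y∈ , z∈ , e′ = go (∈-ins⁻ W c x∈) (∈-ins⁻ W c y∈) (∈-ins⁻ W c z∈)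
    where
    at : ∀ {x y} → x ∈ ins W c → y ∈ ins W c → H v c x y → EdgeInto v c W
    at x∈ y∈ e = _ , _ , ∈-ins-≢ W c x∈ (≢-sym (distinct₂₃ e)) , ∈-ins-≢ W c y∈ (≢-sym (distinct₂₄ e)) , e
    go : x ≡ c ⊎ x ∈ W → y ≡ c ⊎ y ∈ W → z ≡ c ⊎ z ∈ W → EdgeInto v c W
    go (inj₁ refl) _ _ = at y∈ z∈ e′
    go _ (inj₁ refl) _ = at x∈ z∈ (swap₂₃ e′)
    go _ _ (inj₁ refl) = at y∈ x∈ (swap₂₄ e′)
    go (inj₂ x∈) (inj₂ y∈) (inj₂ z∈) = contradiction
      (v , x , y , z , x∈ins W v , W⊆ins W v x∈ , W⊆ins W v y∈ , W⊆ins W v z∈ , e′) iv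

  -- Blockers of a vertex, and how to unblock it

  Blocker : Fin n → Subset n → Fin n → Set
  Blocker v W c = c ∉ W × Indep (ins W c) × EdgeInto v c W

  abstract
    blocker? : ∀ v W c → Dec (Blocker v W c)
    blocker? v W c = ¬? (c ∈? W) ×-dec indep? (ins W c) ×-dec edgeInto? v c W

  #blockers : Fin n → Subset n → ℕ
  #blockers v W = ∑ V (λ c → 𝟙 (blocker? v W c))

  -- U is obtained from W by removing blockers until v can be added.
  Unblocks : Fin n → Subset n → Subset n → Set
  Unblocks v W U = U ⊆ W × Indep (ins U v) × (∀ c → c ∈ W → c ∉ U → Blocker v U c)

  abstract
    unblocks? : ∀ v W U → Dec (Unblocks v W U)
    unblocks? v W U = (U ⊆? W) ×-dec indep? (ins U v) ×-dec
      all? (λ c → (c ∈? W) →-dec (¬? (c ∈? U) →-dec blocker? v U c))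

  -- A greedy scan of the vertices yields a maximal subset of `W` to which `v` can be added; by
  -- maximality every vertex left out is a blocker.
  unblock : ∀ v {W} → Indep W → ∃ (Unblocks v W)
  unblock v {W} iW with go V
    where
    go : ∀ xs → ∃[ U ] (U ⊆ W × Indep (ins U v) ×
         (∀ {c} → c ∈ˡ xs → c ∈ W → c ∉ U → HasEdge (ins (ins U c) v)))
    -- The scan starts from the empty set: `v` alone carries no edge, since the vertices of an edge
    -- are distinct.
    go []       = Subset.⊥ , ⊥-elim ∘ ∉⊥ ,
      (λ { (x , y , _ , _ , x∈ , y∈ , _ , _ , e) → distinct₁₂ e (trans (only x∈) (sym (only y∈))) }) , λ ()
      where
      only : ∀ {x} → x ∈ ins Subset.⊥ v → x ≡ v
      only x∈ = [ id , ⊥-elim ∘ ∉⊥ ]′ (∈-ins⁻ Subset.⊥ v x∈)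
    go (x ∷ xs) with go xs
    ... | U , U⊆W , iU , max with x ∈? W | hasEdge? (ins (ins U x) v)
    ... | no x∉W | _ = U , U⊆W , iU , λ { (here refl) x∈ → contradiction x∈ x∉W ; (there c∈) → max c∈ }
    ... | yes _  | yes e = U , U⊆W , iU , λ { (here refl) _ _ → e ; (there c∈) → max c∈ }
    -- A vertex refused earlier stays refused, since the edge it would create survives in the larger
    -- set.
    ... | yes x∈ | no ¬e = ins U x , Ux⊆W , ¬e , λ
      { (here refl) _ x∉ → contradiction (x∈ins U x) x∉
      ; {c} (there c∈) c∈W c∉ → hasEdge-mono (ins-mono (ins-mono (W⊆ins U x) c) v)
                                  (max c∈ c∈W (c∉ ∘ W⊆ins U x)) }
      where
      Ux⊆W : ins U x ⊆ W
      Ux⊆W y∈ with ∈-ins⁻ U x y∈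
      ... | inj₁ refl = x∈
      ... | inj₂ y∈U  = U⊆W y∈U
  ... | U , U⊆W , iU , max = U , U⊆W , iU , λ c c∈ c∉ →
    let ic = indep-anti (Uc⊆W c∈) iW in c∉ , ic , edgeInto ic iU (max (∈-allFin c) c∈ c∉)
    where
    Uc⊆W : ∀ {c} → c ∈ W → ins U c ⊆ W
    Uc⊆W c∈ y∈ with ∈-ins⁻ U _ y∈
    ... | inj₁ refl = c∈
    ... | inj₂ y∈U  = U⊆W y∈U

  -- Blockers that do not survive the passage from U to W

  Pair Triple : Set
  Pair = Fin n × Fin n
  Triple = Fin n × Pair

  open DecMembership (≡-dec (_≟_ {n}) (_≟_ {n})) using () renaming (_∈?_ to _∈²?_)
  open DecMembership (≡-dec (_≟_ {n}) (≡-dec (_≟_ {n}) (_≟_ {n}))) using () renaming (_∈?_ to _∈³?_)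

  -- A blocker c′ of v in U which is not a blocker of v in W ⊇ U sits in a
  -- triangle of edges v c d e, v c′ a b, c′ c f g with all vertices but v and
  -- c′ in W. If f or g is d or e, it is one of the pairs (v , c′) below;
  -- otherwise some vertex of W is determined by v, c′ and the others.
  coincident : Subset n → List Pair
  coincident W =
    elems W >>= λ c → elems W >>= λ d → elems W >>= λ e → elems W >>= λ g →
    ext c d e >>= λ v → ext c d g >>= λ c′ → (v , c′) ∷ []

  determined₁ determined₂ determined : Subset n → List Triple
  determined₁ U =
    elems U >>= λ a → elems U >>= λ b → elems U >>= λ c →
    elems U >>= λ d → elems U >>= λ f → elems U >>= λ g →
    ext c f g >>= λ c′ → ext c′ a b >>= λ v → ext v c d >>= λ e → (e , v , c′) ∷ []
  determined₂ U =
    elems U >>= λ a → elems U >>= λ b → elems U >>= λ c →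
    elems U >>= λ d → elems U >>= λ e → elems U >>= λ f →
    ext c d e >>= λ v → ext v a b >>= λ c′ → ext c′ c f >>= λ g → (g , v , c′) ∷ []
  determined U = determined₁ U ++ determined₂ U

  -- The list is formed from `W` without `x`, so that the event x ∈ W is still worth a factor 1/q.
  Determined : Subset n → Triple → Set
  Determined W (x , p) = x ∈ W × (x , p) ∈ˡ determined (del W x)

  module _ {W : Subset n} {a b c d e f g v c′ : Fin n}
    (a∈ : a ∈ W) (b∈ : b ∈ W) (c∈ : c ∈ W) (d∈ : d ∈ W) (e∈ : e ∈ W) (f∈ : f ∈ W) (g∈ : g ∈ W)
    (Hvcde : H v c d e) (Hvc′ab : H v c′ a b) (Hc′cfg : H c′ c f g) where

    -- When `f` is `d`, only the four vertices c, d, e, g are needed: `v` comes from c, d, e and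
    -- `c′` from c, d, g.
    coincident⁺ : f ≡ d → (v , c′) ∈ˡ coincident W
    coincident⁺ refl =
      ∈-bind _ (∈-elems⁺ W c∈) (∈-bind _ (∈-elems⁺ W d∈) (∈-bind _ (∈-elems⁺ W e∈) (∈-bind _ (∈-elems⁺ W g∈)
      (∈-bind _ (ext-complete (rotate Hvcde)) (∈-bind _ (ext-complete (rotate Hc′cfg)) (here refl))))))

    -- Here `e` lies only in the edge v c d e, so it is reconstructed last: first `c′` from c, f, g,
    -- then `v` from c′, a, b.
    determined₁⁺ : e ≢ a → e ≢ b → e ≢ f → e ≢ g → Determined W (e , v , c′)
    determined₁⁺ e≢a e≢b e≢f e≢g = e∈ , ∈-++⁺ˡ
      (∈-bind _ (kept a∈ e≢a) (∈-bind _ (kept b∈ e≢b) (∈-bind _ (kept c∈ (≢-sym (distinct₂₄ Hvcde)))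
      (∈-bind _ (kept d∈ (≢-sym (distinct₃₄ Hvcde))) (∈-bind _ (kept f∈ e≢f) (∈-bind _ (kept g∈ e≢g)
      (∈-bind _ (ext-complete (rotate Hc′cfg)) (∈-bind _ (ext-complete (rotate Hvc′ab))
      (∈-bind _ (ext-complete Hvcde) (here refl))))))))))
      where
      kept : ∀ {x} → x ∈ W → e ≢ x → x ∈ˡ elems (del W e)
      kept x∈ e≢x = ∈-elems⁺ (del W e) (∈-del⁺ W e x∈ (≢-sym e≢x))

    -- Here `g` lies only in the edge c′ c f g: first comes `v` from c, d, e, then `c′` from v, a,
    -- b, and `g` last.
    determined₂⁺ : g ≢ a → g ≢ b → g ≢ d → g ≢ e → Determined W (g , v , c′)
    determined₂⁺ g≢a g≢b g≢d g≢e = g∈ , ∈-++⁺ʳ (determined₁ (del W g))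
      (∈-bind _ (kept a∈ g≢a) (∈-bind _ (kept b∈ g≢b) (∈-bind _ (kept c∈ (≢-sym (distinct₂₄ Hc′cfg)))
      (∈-bind _ (kept d∈ g≢d) (∈-bind _ (kept e∈ g≢e) (∈-bind _ (kept f∈ (≢-sym (distinct₃₄ Hc′cfg)))
      (∈-bind _ (ext-complete (rotate Hvcde)) (∈-bind _ (ext-complete (swap₃₄ (swap₂₃ Hvc′ab)))
      (∈-bind _ (ext-complete Hc′cfg) (here refl))))))))))
      where
      kept : ∀ {x} → x ∈ W → g ≢ x → x ∈ˡ elems (del W g)
      kept x∈ g≢x = ∈-elems⁺ (del W g) (∈-del⁺ W g x∈ (≢-sym g≢x))

  Lost : Subset n → Pair → Set
  Lost W p = p ∈ˡ coincident W ⊎ ∃ λ x → Determined W (x , p)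

  -- If {f, g} misses {d, e}, then either one of d, e also misses {a, b} and is reconstructed last,
  -- or {d, e} = {a, b} and `g` is.
  triangle-lost : ∀ {W a b c d e f g v c′} →
    a ∈ W → b ∈ W → c ∈ W → d ∈ W → e ∈ W → f ∈ W → g ∈ W →
    H v c d e → H v c′ a b → H c′ c f g → Lost W (v , c′)
  triangle-lost {a = a} {b} {c} {d} {e} {f} {g} a∈ b∈ c∈ d∈ e∈ f∈ g∈ hv hb hc
    with f ≟ d | f ≟ e | g ≟ d | g ≟ e
  ... | yes f≡d | _ | _ | _ = inj₁ (coincident⁺ a∈ b∈ c∈ d∈ e∈ f∈ g∈ hv hb hc f≡d)
  ... | _ | yes f≡e | _ | _ = inj₁ (coincident⁺ a∈ b∈ c∈ e∈ d∈ f∈ g∈ (swap₃₄ hv) hb hc f≡e)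
  ... | _ | _ | yes g≡d | _ = inj₁ (coincident⁺ a∈ b∈ c∈ d∈ e∈ g∈ f∈ hv hb (swap₃₄ hc) g≡d)
  ... | _ | _ | _ | yes g≡e = inj₁ (coincident⁺ a∈ b∈ c∈ e∈ d∈ g∈ f∈ (swap₃₄ hv) hb (swap₃₄ hc) g≡e)
  ... | no f≢d | no f≢e | no g≢d | no g≢e with e ≟ a | e ≟ b | d ≟ a | d ≟ b
  ... | no e≢a | no e≢b | _ | _ =
    inj₂ (e , determined₁⁺ a∈ b∈ c∈ d∈ e∈ f∈ g∈ hv hb hc e≢a e≢b (≢-sym f≢e) (≢-sym g≢e))
  ... | _ | _ | no d≢a | no d≢b =
    inj₂ (d , determined₁⁺ a∈ b∈ c∈ e∈ d∈ f∈ g∈ (swap₃₄ hv) hb hc d≢a d≢b (≢-sym f≢d) (≢-sym g≢d))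
  ... | yes refl | _ | yes refl | _ = contradiction refl (distinct₃₄ hv)
  ... | _ | yes refl | _ | yes refl = contradiction refl (distinct₃₄ hv)
  ... | yes refl | _ | _ | yes refl =
    inj₂ (g , determined₂⁺ a∈ b∈ c∈ d∈ e∈ f∈ g∈ hv hb hc g≢e g≢d g≢d g≢e)
  ... | _ | yes refl | yes refl | _ =
    inj₂ (g , determined₂⁺ a∈ b∈ c∈ d∈ e∈ f∈ g∈ hv hb hc g≢d g≢e g≢d g≢e)

  -- If `c′` lies outside `W` and cannot be added to it, the edge this creates uses a vertex c of
  -- `W` outside `U`, because `c′` can be added to `U`. That c was removed as a blocker of `v`, and
  -- its edge with `v` closes the triangle.
  blocker-persists : ∀ {v W U c′} → Indep W → Unblocks v W U → Blocker v U c′ →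
                     Blocker v W c′ ⊎ c′ ∈ W ⊎ Lost W (v , c′)
  blocker-persists {v} {W} {U} {c′} iW (U⊆W , iU , removed) (c′∉U , iUc′ , a , b , a∈ , b∈ , hb)
    with c′ ∈? W | hasEdge? (ins W c′)
  ... | yes c′∈ | _     = inj₂ (inj₁ c′∈)
  ... | no c′∉  | no ¬e = inj₁ (c′∉ , ¬e , edgeInto-mono U⊆W (a , b , a∈ , b∈ , hb))
  ... | no c′∉  | yes e with edge-through iW e
  ...   | x , y , z , x∈ , y∈ , z∈ , hc = inj₂ (inj₂ (go (x ∈? U) (y ∈? U) (z ∈? U)))
    where
    lost : ∀ {c f g} → c ∈ W → c ∉ U → f ∈ W → g ∈ W → H c′ c f g → Lost W (v , c′)
    lost c∈ c∉ f∈ g∈ hc with removed _ c∈ c∉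
    ... | _ , _ , d , e , d∈ , e∈ , hv =
      triangle-lost (U⊆W a∈) (U⊆W b∈) c∈ (U⊆W d∈) (U⊆W e∈) f∈ g∈ hv hb hc
    go : Dec (x ∈ U) → Dec (y ∈ U) → Dec (z ∈ U) → Lost W (v , c′)
    go (no x∉) _ _ = lost x∈ x∉ y∈ z∈ hc
    go _ (no y∉) _ = lost y∈ y∉ x∈ z∈ (swap₂₃ hc)
    go _ _ (no z∉) = lost z∈ z∉ y∈ x∈ (swap₂₄ hc)
    go (yes x∈U) (yes y∈U) (yes z∈U) = contradiction
      (c′ , x , y , z , x∈ins U c′ , W⊆ins U c′ x∈U , W⊆ins U c′ y∈U , W⊆ins U c′ z∈U , hc) iUc′

  abstract
    light? : ∀ M v W U → Dec (Unblocks v W U × #blockers v U ≤ M)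
    light? M v W U = unblocks? v W U ×-dec (#blockers v U ≤? M)

  #lost : Subset n → Pair → ℕ
  #lost W p = 𝟙 (p ∈²? coincident W) + ∑ V (λ x → 𝟙 (x ∈? W) * 𝟙 ((x , p) ∈³? determined (del W x)))

  lost-counted : ∀ {W p} → Lost W p → 1 ≤ #lost W p
  lost-counted {W} {p} (inj₁ p∈) = m≤n⇒m≤n+o _ (𝟙-≥1 (p ∈²? coincident W) p∈)
  lost-counted {W} {p} (inj₂ (x , x∈ , xp∈)) = m≤n⇒m≤o+n (𝟙 (p ∈²? coincident W))
    (≤-trans (*-mono-≤ (𝟙-≥1 (x ∈? W) x∈) (𝟙-≥1 ((x , p) ∈³? determined (del W x)) xp∈))
      (∑-∈ (λ x → 𝟙 (x ∈? W) * 𝟙 ((x , p) ∈³? determined (del W x))) (∈-allFin x)))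

  size≡∑ : ∀ W → ∑ V (λ x → 𝟙 (x ∈? W)) ≡ size W
  size≡∑ W = ∑𝟙≡length-filter (_∈? W) V

  -- Take the `U` given by `unblock`. With at most `M` blockers it makes the first sum at least 1;
  -- otherwise its more than `M` blockers are distributed over the three cases of
  -- `blocker-persists`.
  light-or-blocked : ∀ M v {W} → Indep W →
    M ≤ M * ∑ (subsets n) (λ U → 𝟙 (light? M v W U))
        + (#blockers v W + (size W + ∑ V (λ c → #lost W (v , c))))
  light-or-blocked M v {W} iW with unblock v iW
  ... | U , ub with #blockers v U ≤? M
  ...   | yes few = m≤n⇒m≤n+o _
    (≤-trans (≤-reflexive (sym (*-identityʳ M)))
      (*-monoʳ-≤ M (≤-trans (𝟙-≥1 (light? M v W U) (ub , few))
        (∑-∈ (λ U → 𝟙 (light? M v W U)) (∈-subsets U)))))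
  ...   | no many = begin
    M                                                          ≤⟨ <⇒≤ (≰⇒> many) ⟩
    #blockers v U                                              ≤⟨ ∑-mono V pointwise ⟩
    ∑ V (λ c → 𝟙 (blocker? v W c) + (𝟙 (c ∈? W) + #lost W (v , c)))
      ≡⟨ ∑-+ V _ _ ⟩
    #blockers v W + ∑ V (λ c → 𝟙 (c ∈? W) + #lost W (v , c))
      ≡⟨ cong (#blockers v W +_) (∑-+ V _ _) ⟩
    #blockers v W + (∑ V (λ c → 𝟙 (c ∈? W)) + ∑ V (λ c → #lost W (v , c)))
      ≡⟨ cong (λ s → #blockers v W + (s + ∑ V (λ c → #lost W (v , c)))) (size≡∑ W) ⟩
    #blockers v W + (size W + ∑ V (λ c → #lost W (v , c)))     ≤⟨ m≤n+m _ (M * ∑ (subsets n) (λ U → 𝟙 (light? M v W U))) ⟩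
    _ ∎
    where
    open ≤-Reasoning
    pointwise : ∀ c → 𝟙 (blocker? v U c) ≤ 𝟙 (blocker? v W c) + (𝟙 (c ∈? W) + #lost W (v , c))
    pointwise c = 𝟙-≤ (blocker? v U c) λ blk → case blocker-persists iW ub blk of λ
      { (inj₁ blkW)      → m≤n⇒m≤n+o _ (𝟙-≥1 (blocker? v W c) blkW)
      ; (inj₂ (inj₁ c∈)) → m≤n⇒m≤o+n (𝟙 (blocker? v W c)) (m≤n⇒m≤n+o _ (𝟙-≥1 (c ∈? W) c∈))
      ; (inj₂ (inj₂ l))  → m≤n⇒m≤o+n (𝟙 (blocker? v W c)) (m≤n⇒m≤o+n (𝟙 (c ∈? W)) (lost-counted l)) }

  pairs : List Pair
  pairs = cartesianProduct V V

  pairs-unique : Unique pairs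
  pairs-unique = cartesianProduct⁺ (allFin⁺ n) (allFin⁺ n)

  ∑-V-const : ∀ k → ∑ V (λ _ → k) ≡ n * k
  ∑-V-const k = trans (∑-const V k) (cong (_* k) (length-tabulate {n = n} id))

  light-or-blocked-∑ : ∀ M {W} → Indep W →
    n * M ≤ M * ∑ V (λ v → ∑ (subsets n) (λ U → 𝟙 (light? M v W U)))
            + (∑ pairs (λ (v , c) → 𝟙 (blocker? v W c)) + (n * size W + ∑ pairs (#lost W)))
  light-or-blocked-∑ M {W} iW = begin
    n * M                                                    ≡⟨ sym (∑-V-const M) ⟩
    ∑ V (λ _ → M)                                            ≤⟨ ∑-mono V (λ v → light-or-blocked M v iW) ⟩
    ∑ V (λ v → M * ∑ (subsets n) (λ U → 𝟙 (light? M v W U))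
                + (#blockers v W + (size W + ∑ V (λ c → #lost W (v , c)))))
      ≡⟨ ∑-+ V _ _ ⟩
    ∑ V (λ v → M * ∑ (subsets n) (λ U → 𝟙 (light? M v W U)))
      + ∑ V (λ v → #blockers v W + (size W + ∑ V (λ c → #lost W (v , c))))
      ≡⟨ cong₂ _+_ (∑-*ˡ M V _) (trans (∑-+ V _ _) (cong₂ _+_ (sym (∑-cartesianProduct V V _))
           (trans (∑-+ V _ _) (cong₂ _+_ (∑-V-const (size W)) (sym (∑-cartesianProduct V V (#lost W))))))) ⟩
    _ ∎
    where open ≤-Reasoning

  -- Expectations over independent sets of bounded size

  Small Smaller : Subset n → Set
  Small   W = Indep W × size W ≤ R
  -- The strict bound leaves room for one more vertex: an admissible addition leads from `Smaller`
  -- to `Small`.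
  Smaller W = Indep W × size W < R

  abstract
    small? : ∀ W → Dec (Small W)
    small? W = indep? W ×-dec (size W ≤? R)

  abstract
    smaller? : ∀ W → Dec (Smaller W)
    smaller? W = indep? W ×-dec (size W <? R)

  small-anti : ∀ {U W} → U ⊆ W → Small W → Small U
  small-anti U⊆W (iW , sW) = indep-anti U⊆W iW , ≤-trans (size-mono U⊆W) sW

  open Restricted small?   using () renaming
    (𝔼ₚ to 𝔼≤; 𝔼ₚ-mono to 𝔼≤-mono; 𝔼ₚ-+ to 𝔼≤-+; 𝔼ₚ-∑ to 𝔼≤-∑; 𝔼ₚ-bound to 𝔼≤-bound; total to Z≤) public
  open Restricted smaller? using () renaming
    (𝔼ₚ to 𝔼<; 𝔼ₚ-mono to 𝔼<-mono; 𝔼ₚ-+ to 𝔼<-+; 𝔼ₚ-*ˡ to 𝔼<-*; 𝔼ₚ-∑ to 𝔼<-∑; total to Z<) public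

  𝔼<≤𝔼≤ : ∀ f → 𝔼< f ≤ 𝔼≤ f
  𝔼<≤𝔼≤ f = 𝔼-mono (λ W → *-monoˡ-≤ (f W) (𝟙-mono (smaller? W) (small? W) (λ (i , s) → i , <⇒≤ s)))

  -- As `Small` is closed under taking subsets, containing `x` has probability at most 1/q, even
  -- jointly with any event about the rest of the set.
  𝔼≤-removal : ∀ x {f : Subset n → ℕ} → q * 𝔼≤ (λ W → 𝟙 (x ∈? W) * f (del W x)) ≤ 𝔼≤ f
  𝔼≤-removal x {f} = ≤-trans
    (≤-reflexive (cong (q *_) (𝔼-cong (λ W → *-comm-middle (𝟙 (small? W)) (𝟙 (x ∈? W)) _))))
    (𝔼-removal-≤ x (λ W x∈ → *-monoˡ-≤ (f (del W x))
      (𝟙-mono (small? W) (small? (del W x)) (small-anti (∈-del⁻ W x)))))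

  elems-length : ∀ {W k} {A : Set} (f : Fin n → List A) → Small W → (∀ x → length (f x) ≤ k) →
                 length (elems W >>= f) ≤ R * k
  elems-length {W} f (_ , sW) = length-bind {xs = elems W} f sW

  ext-length-bind : ∀ {x y z k} {A : Set} (f : Fin n → List A) → (∀ x → length (f x) ≤ k) →
                    length (ext x y z >>= f) ≤ D * k
  ext-length-bind {x} {y} {z} f = length-bind {xs = ext x y z} f (ext-length x y z)

  R⁴D² R⁶D³ : ℕ
  R⁴D² = R * (R * (R * (R * (D * (D * 1)))))
  R⁶D³ = R * (R * (R * (R * (R * (R * (D * (D * (D * 1))))))))

  coincident-length : ∀ {W} → Small W → length (coincident W) ≤ R⁴D²
  coincident-length s =
    elems-length _ s λ _ → elems-length _ s λ _ → elems-length _ s λ _ → elems-length _ s λ _ →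
    ext-length-bind _ λ _ → ext-length-bind _ λ _ → ≤-refl

  determined-length : ∀ {W} → Small W → length (determined W) ≤ 2 * R⁶D³
  determined-length {W} s = begin
    length (determined W)                              ≡⟨ length-++ (determined₁ W) ⟩
    length (determined₁ W) + length (determined₂ W)    ≤⟨ +-mono-≤
      (elems-length _ s λ _ → elems-length _ s λ _ → elems-length _ s λ _ →
       elems-length _ s λ _ → elems-length _ s λ _ → elems-length _ s λ _ →
       ext-length-bind _ λ _ → ext-length-bind _ λ _ → ext-length-bind _ λ _ → ≤-refl {1})
      (elems-length _ s λ _ → elems-length _ s λ _ → elems-length _ s λ _ →
       elems-length _ s λ _ → elems-length _ s λ _ → elems-length _ s λ _ →
       ext-length-bind _ λ _ → ext-length-bind _ λ _ → ext-length-bind _ λ _ → ≤-refl {1}) ⟩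
    R⁶D³ + R⁶D³                                        ≡⟨ cong (R⁶D³ +_) (sym (+-identityʳ _)) ⟩
    2 * R⁶D³ ∎
    where open ≤-Reasoning

  -- Coincident pairs are few in every small set. The determined triples are more numerous, but gain
  -- a factor 1/q from the determined vertex; `Y` replaces the quotient 2R⁶D³/q.
  𝔼-lost : ∀ {Y} → 0 < q → 2 * R⁶D³ ≤ q * Y →
           𝔼≤ (λ W → ∑ pairs (#lost W)) ≤ (R⁴D² + Y) * Z≤
  𝔼-lost {Y} q>0 qY = begin
    𝔼≤ (λ W → ∑ pairs (#lost W))
      ≡⟨ 𝔼-cong (λ W → cong (𝟙 (small? W) *_) (∑-+ pairs _ _)) ⟩
    𝔼≤ (λ W → ∑ pairs (λ p → 𝟙 (p ∈²? coincident W)) + ∑ pairs (λ p → ∑ V (λ x → removed x p W)))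
      ≡⟨ 𝔼≤-+ _ _ ⟩
    𝔼≤ (λ W → ∑ pairs (λ p → 𝟙 (p ∈²? coincident W))) + 𝔼≤ (λ W → ∑ pairs (λ p → ∑ V (λ x → removed x p W)))
      ≤⟨ +-mono-≤ (𝔼≤-bound _ (λ W s → ≤-trans (count-≤ (_∈²? coincident W) pairs-unique (λ _ p∈ → p∈))
                                                (coincident-length s)))
                  (*-cancelˡ-≤ q {{>-nonZero q>0}} q-lost) ⟩
    R⁴D² * Z≤ + Y * Z≤
      ≡⟨ sym (*-distribʳ-+ Z≤ R⁴D² Y) ⟩
    _ ∎
    where
    open ≤-Reasoning
    removed : Fin n → Pair → Subset n → ℕ
    removed x p W = 𝟙 (x ∈? W) * 𝟙 ((x , p) ∈³? determined (del W x))
    triples : List Triple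
    triples = cartesianProduct V pairs
    q-lost : q * 𝔼≤ (λ W → ∑ pairs (λ p → ∑ V (λ x → removed x p W))) ≤ q * (Y * Z≤)
    q-lost = begin
      q * 𝔼≤ (λ W → ∑ pairs (λ p → ∑ V (λ x → removed x p W)))
        ≡⟨ cong (q *_) (trans (𝔼-cong (λ W → cong (𝟙 (small? W) *_)
             (trans (∑-swap pairs V _) (sym (∑-cartesianProduct V pairs (λ (x , p) → removed x p W))))))
             (𝔼≤-∑ triples (λ (x , p) → removed x p))) ⟩
      q * ∑ triples (λ (x , p) → 𝔼≤ (removed x p))
        ≡⟨ sym (∑-*ˡ q triples _) ⟩
      ∑ triples (λ (x , p) → q * 𝔼≤ (removed x p))
        ≤⟨ ∑-mono triples (λ (x , p) → 𝔼≤-removal x) ⟩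
      ∑ triples (λ t → 𝔼≤ (λ W → 𝟙 (t ∈³? determined W)))
        ≡⟨ sym (𝔼≤-∑ triples _) ⟩
      𝔼≤ (λ W → ∑ triples (λ t → 𝟙 (t ∈³? determined W)))
        ≤⟨ 𝔼≤-bound _ (λ W s → ≤-trans
             (count-≤ (_∈³? determined W) (cartesianProduct⁺ (allFin⁺ n) pairs-unique) (λ _ t∈ → t∈))
             (determined-length s)) ⟩
      2 * R⁶D³ * Z≤   ≤⟨ *-monoˡ-≤ Z≤ qY ⟩
      q * Y * Z≤                 ≡⟨ *-assoc q Y Z≤ ⟩
      q * (Y * Z≤) ∎

  -- Every triple of vertices of `W` blocks at most `D` vertices, whence the length R³D.
  blocking : Subset n → List Pair
  blocking W = elems W >>= λ c → elems W >>= λ a → elems W >>= λ b → ext c a b >>= λ v → (v , c) ∷ []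

  R³D : ℕ
  R³D = R * (R * (R * (D * 1)))

  blocking-length : ∀ {W} → Small W → length (blocking W) ≤ R³D
  blocking-length s = elems-length _ s λ _ → elems-length _ s λ _ → elems-length _ s λ _ →
    ext-length-bind _ λ _ → ≤-refl

  abstract
    addable? : ∀ v U → Dec (size U < R × Indep (ins U v))
    addable? v U = (size U <? R) ×-dec indep? (ins U v)

  small-from-addable : ∀ {v W} → v ∈ W → size (del W v) < R × Indep (ins (del W v) v) → Small W
  small-from-addable {v} {W} v∈ (s , i) =
    indep-anti W⊆ i , ≤-trans (size-mono W⊆) (≤-trans (size-ins (del W v) v) s)
    where
    W⊆ : W ⊆ ins (del W v) v
    W⊆ {x} x∈ with x ≟ v
    ... | yes refl = x∈ins (del W v) v
    ... | no x≢v   = W⊆ins (del W v) v (∈-del⁺ W v x∈ x≢v)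

  -- Adding the blocker `c` to `W` gives a small set that contains a whole triple blocking `v`, and
  -- divides the weight by `q`.
  𝔼-blocker : ∀ v c → 𝔼< (λ W → 𝟙 (blocker? v W c)) ≤ q * 𝔼≤ (λ W → 𝟙 ((v , c) ∈²? blocking W))
  𝔼-blocker v c = begin
    𝔼 (λ W → 𝟙 (smaller? W) * 𝟙 (blocker? v W c))
      ≤⟨ 𝔼-mono (λ W → 𝟙*-≤ (smaller? W) λ (_ , s) → 𝟙-≤ (blocker? v W c) λ (c∉ , i , e) →
           *-mono-≤ (𝟙-≥1 (¬? (c ∈? W)) c∉) (*-mono-≤ (𝟙-≥1 (addable? c W) (s , i)) (𝟙-≥1 (edgeInto? v c W) e))) ⟩
    𝔼 (λ W → 𝟙 (¬? (c ∈? W)) * (𝟙 (addable? c W) * 𝟙 (edgeInto? v c W)))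
      ≡⟨ sym (𝔼-removal c (λ W → 𝟙 (addable? c W) * 𝟙 (edgeInto? v c W))) ⟩
    q * 𝔼 (λ W → 𝟙 (c ∈? W) * (𝟙 (addable? c (del W c)) * 𝟙 (edgeInto? v c (del W c))))
      ≤⟨ *-monoʳ-≤ q (𝔼-mono (λ W → 𝟙*-≤ (c ∈? W) λ c∈ → 𝟙*-≤ (addable? c (del W c)) λ add →
           𝟙-≤ (edgeInto? v c (del W c)) λ (a , b , a∈ , b∈ , e) →
           *-mono-≤ (𝟙-≥1 (small? W) (small-from-addable c∈ add)) (𝟙-≥1 ((v , c) ∈²? blocking W)
             (∈-bind _ (∈-elems⁺ W c∈) (∈-bind _ (∈-elems⁺ W (∈-del⁻ W c a∈)) (∈-bind _ (∈-elems⁺ W (∈-del⁻ W c b∈))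
               (∈-bind _ (ext-complete (rotate e)) (here refl)))))))) ⟩
    q * 𝔼≤ (λ W → 𝟙 ((v , c) ∈²? blocking W)) ∎
    where open ≤-Reasoning

  𝔼-blockers : 𝔼< (λ W → ∑ pairs (λ (v , c) → 𝟙 (blocker? v W c))) ≤ q * (R³D * Z≤)
  𝔼-blockers = begin
    𝔼< (λ W → ∑ pairs (λ (v , c) → 𝟙 (blocker? v W c)))
      ≡⟨ 𝔼<-∑ pairs (λ (v , c) W → 𝟙 (blocker? v W c)) ⟩
    ∑ pairs (λ (v , c) → 𝔼< (λ W → 𝟙 (blocker? v W c)))
      ≤⟨ ∑-mono pairs (λ (v , c) → 𝔼-blocker v c) ⟩
    ∑ pairs (λ p → q * 𝔼≤ (λ W → 𝟙 (p ∈²? blocking W)))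
      ≡⟨ ∑-*ˡ q pairs _ ⟩
    q * ∑ pairs (λ p → 𝔼≤ (λ W → 𝟙 (p ∈²? blocking W)))
      ≡⟨ cong (q *_) (sym (𝔼≤-∑ pairs (λ p W → 𝟙 (p ∈²? blocking W)))) ⟩
    q * 𝔼≤ (λ W → ∑ pairs (λ p → 𝟙 (p ∈²? blocking W)))
      ≤⟨ *-monoʳ-≤ q (𝔼≤-bound R³D (λ W s → ≤-trans
           (count-≤ (_∈²? blocking W) pairs-unique (λ _ p∈ → p∈)) (blocking-length s))) ⟩
    q * (R³D * Z≤) ∎
    where open ≤-Reasoning

  -- If v ∈ U, then `U` is itself a small set containing `v`; otherwise U + v is one, at 1/q of the
  -- weight. This gives the factor 1 + q.
  𝔼-addable : ∀ v → 𝔼 (λ U → 𝟙 (addable? v U)) ≤ suc q * 𝔼≤ (λ W → 𝟙 (v ∈? W))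
  𝔼-addable v = begin
    𝔼 (λ U → 𝟙 (addable? v U))
      ≡⟨ 𝔼-cong (λ U → trans (sym (*-identityˡ _)) (trans (cong (_* 𝟙 (addable? v U)) (sym (𝟙-complement (v ∈? U))))
           (*-distribʳ-+ (𝟙 (addable? v U)) (𝟙 (v ∈? U)) _))) ⟩
    𝔼 (λ U → 𝟙 (v ∈? U) * 𝟙 (addable? v U) + 𝟙 (¬? (v ∈? U)) * 𝟙 (addable? v U))
      ≡⟨ 𝔼-+ (λ U → 𝟙 (v ∈? U) * 𝟙 (addable? v U)) _ ⟩
    𝔼 (λ U → 𝟙 (v ∈? U) * 𝟙 (addable? v U)) + 𝔼 (λ U → 𝟙 (¬? (v ∈? U)) * 𝟙 (addable? v U))
      ≡⟨ cong (𝔼 (λ U → 𝟙 (v ∈? U) * 𝟙 (addable? v U)) +_) (sym (𝔼-removal v (λ U → 𝟙 (addable? v U)))) ⟩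
    𝔼 (λ U → 𝟙 (v ∈? U) * 𝟙 (addable? v U)) + q * 𝔼 (λ W → 𝟙 (v ∈? W) * 𝟙 (addable? v (del W v)))
      ≤⟨ +-mono-≤
           (𝔼-mono (λ U → 𝟙*-≤ (v ∈? U) λ v∈ → 𝟙-≤ (addable? v U) λ (s , i) →
              *-mono-≤ (𝟙-≥1 (small? U) (indep-anti (W⊆ins U v) i , <⇒≤ s)) (𝟙-≥1 (v ∈? U) v∈)))
           (*-monoʳ-≤ q (𝔼-mono (λ W → 𝟙*-≤ (v ∈? W) λ v∈ → 𝟙-≤ (addable? v (del W v)) λ add →
              *-mono-≤ (𝟙-≥1 (small? W) (small-from-addable v∈ add)) (𝟙-≥1 (v ∈? W) v∈)))) ⟩
    suc q * 𝔼≤ (λ W → 𝟙 (v ∈? W)) ∎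
    where open ≤-Reasoning

  -- Sets below the full size are rare

  module _ {M T : ℕ} (q>0 : 0 < q) (growth : ∀ x → x ≤ M → suc q ^ x ≤ T * q ^ x) where

    blockers : Fin n → Subset n → Subset n
    blockers v U = Vec.tabulate (does ∘ blocker? v U)

    -- The sets between `U` and the union of `U` with its blockers weigh together at most (1 +
    -- 1/q)^M times `U`, and `growth` bounds this factor by `T`.
    𝔼-between-few : ∀ v U → #blockers v U ≤ M → 𝔼 (between U (blockers v U)) ≤ T * weight U
    𝔼-between-few v U few = *-cancelʳ-≤ _ _ (q ^ ∣ B ∣) {{m^n≢0 q ∣ B ∣ {{>-nonZero q>0}}}} (begin
      𝔼 (between U B) * q ^ ∣ B ∣      ≤⟨ 𝔼-between U B ⟩
      weight U * suc q ^ ∣ B ∣         ≤⟨ *-monoʳ-≤ (weight U) (growth ∣ B ∣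
                                            (≤-trans (≤-reflexive (∣tabulate∣ (blocker? v U))) few)) ⟩
      weight U * (T * q ^ ∣ B ∣)       ≡⟨ *-comm-middle (weight U) T _ ⟩
      T * (weight U * q ^ ∣ B ∣)       ≡⟨ sym (*-assoc T (weight U) _) ⟩
      T * weight U * q ^ ∣ B ∣ ∎)
      where
      open ≤-Reasoning
      B : Subset n
      B = blockers v U

    -- A set leading to `U` lies between `U` and the union of `U` with its blockers. If `v` is not
    -- addable to `U`, or `U` has more than `M` blockers, the left side vanishes.
    𝔼-light₁ : ∀ v U → 𝔼< (λ W → 𝟙 (light? M v W U)) ≤ T * (weight U * 𝟙 (addable? v U))
    𝔼-light₁ v U with addable? v U | #blockers v U ≤? M
    ... | yes _ | yes few = begin
      𝔼< (λ W → 𝟙 (light? M v W U))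
        ≤⟨ 𝔼-mono (λ W → 𝟙*-≤ (smaller? W) λ _ → 𝟙-≤ (light? M v W U) λ ((U⊆W , _ , removed) , _) →
             between≥1 U (blockers v U) W U⊆W (λ x∈ x∉ → ∈-tabulate⁺ (blocker? v U) (removed _ x∈ x∉))) ⟩
      𝔼 (between U (blockers v U))   ≤⟨ 𝔼-between-few v U few ⟩
      T * weight U                   ≡⟨ cong (T *_) (sym (*-identityʳ _)) ⟩
      T * (weight U * 1) ∎
      where open ≤-Reasoning
    ... | yes _ | no many = ≤-trans
      (𝔼-mono (λ W → 𝟙*-≤ (smaller? W) λ _ → 𝟙-≤ (light? M v W U) λ (_ , few) → contradiction few many))
      (≤-trans (≤-reflexive (𝔼-0 n)) z≤n)
    ... | no ¬add | _ = ≤-trans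
      (𝔼-mono (λ W → 𝟙*-≤ (smaller? W) λ (_ , s) → 𝟙-≤ (light? M v W U) λ ((U⊆W , i , _) , _) →
         contradiction (≤-<-trans (size-mono U⊆W) s , i) ¬add))
      (≤-trans (≤-reflexive (𝔼-0 n)) z≤n)

    -- Summed over `v`, the bounds of `𝔼-addable` add up to q + 1 times the expectation of the size,
    -- which is at most `R`.
    𝔼-light : 𝔼< (λ W → ∑ V (λ v → ∑ (subsets n) (λ U → 𝟙 (light? M v W U)))) ≤ T * (suc q * (R * Z≤))
    𝔼-light = begin
      𝔼< (λ W → ∑ V (λ v → ∑ (subsets n) (λ U → 𝟙 (light? M v W U))))
        ≡⟨ trans (𝔼<-∑ V (λ v W → ∑ (subsets n) (λ U → 𝟙 (light? M v W U))))
             (∑-cong V (λ v → 𝔼<-∑ (subsets n) (λ U W → 𝟙 (light? M v W U)))) ⟩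
      ∑ V (λ v → ∑ (subsets n) (λ U → 𝔼< (λ W → 𝟙 (light? M v W U))))
        ≤⟨ ∑-mono V (λ v → ∑-mono (subsets n) (𝔼-light₁ v)) ⟩
      ∑ V (λ v → ∑ (subsets n) (λ U → T * (weight U * 𝟙 (addable? v U))))
        ≡⟨ trans (∑-cong V (λ v → ∑-*ˡ T (subsets n) _)) (∑-*ˡ T V _) ⟩
      T * ∑ V (λ v → 𝔼 (λ U → 𝟙 (addable? v U)))
        ≤⟨ *-monoʳ-≤ T (∑-mono V 𝔼-addable) ⟩
      T * ∑ V (λ v → suc q * 𝔼≤ (λ W → 𝟙 (v ∈? W)))
        ≡⟨ cong (T *_) (trans (∑-*ˡ (suc q) V _) (cong (suc q *_) (sym (𝔼≤-∑ V (λ v W → 𝟙 (v ∈? W)))))) ⟩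
      T * (suc q * 𝔼≤ (λ W → ∑ V (λ v → 𝟙 (v ∈? W))))
        ≤⟨ *-monoʳ-≤ T (*-monoʳ-≤ (suc q) (𝔼≤-bound R (λ W (_ , s) → ≤-trans (≤-reflexive (size≡∑ W)) s))) ⟩
      T * (suc q * (R * Z≤)) ∎
      where open ≤-Reasoning

    -- This is `light-or-blocked-∑` integrated over the sets of size below `R`: once n M exceeds the
    -- bracket by a constant factor, these sets carry little of the weight.
    smaller-rare : ∀ {Y} → 2 * R⁶D³ ≤ q * Y →
      n * M * Z< ≤ (M * (T * (suc q * R)) + (q * R³D + (n * R + (R⁴D² + Y)))) * Z≤
    smaller-rare {Y} qY = begin
      n * M * Z<
        ≡⟨ sym (𝔼<-* (n * M) (λ _ → 1)) ⟩
      𝔼< (λ _ → n * M * 1)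
        ≤⟨ 𝔼<-mono (λ W (i , _) → ≤-trans (≤-reflexive (*-identityʳ (n * M))) (light-or-blocked-∑ M i)) ⟩
      𝔼< (λ W → M * light W + (blk W + (n * size W + lost W)))
        ≡⟨ trans (𝔼<-+ _ _) (cong₂ _+_ (𝔼<-* M light) (trans (𝔼<-+ _ _) (cong (𝔼< blk +_)
             (trans (𝔼<-+ _ _) (cong (_+ 𝔼< lost) (𝔼<-* n size)))))) ⟩
      M * 𝔼< light + (𝔼< blk + (n * 𝔼< size + 𝔼< lost))
        ≤⟨ +-mono-≤ (*-monoʳ-≤ M 𝔼-light) (+-mono-≤ 𝔼-blockers (+-mono-≤
             (*-monoʳ-≤ n (≤-trans (𝔼<≤𝔼≤ size) (𝔼≤-bound R (λ _ → proj₂))))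
             (≤-trans (𝔼<≤𝔼≤ lost) (𝔼-lost q>0 qY)))) ⟩
      M * (T * (suc q * (R * Z≤))) + (q * (R³D * Z≤) + (n * (R * Z≤) + (R⁴D² + Y) * Z≤))
        ≡⟨ regroup M T (suc q) R Z≤ q R³D n (R⁴D² + Y) ⟩
      (M * (T * (suc q * R)) + (q * R³D + (n * R + (R⁴D² + Y)))) * Z≤ ∎
      where
      open ≤-Reasoning
      light blk lost : Subset n → ℕ
      light W = ∑ V (λ v → ∑ (subsets n) (λ U → 𝟙 (light? M v W U)))
      blk W = ∑ pairs (λ (v , c) → 𝟙 (blocker? v W c))
      lost W = ∑ pairs (#lost W)
      regroup : ∀ a b c d z e f g h → a * (b * (c * (d * z))) + (e * (f * z) + (g * (d * z) + h * z))
                ≡ (a * (b * (c * d)) + (e * f + (g * d + h))) * z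
      regroup = solve-∀


-- Full-size independent sets with few cherries

module FewCherries {n D : ℕ} (G : Hypergraph n D) (R q : ℕ) where

  open Hypergraph G
  open HardCore G R q
  open Weights q

  module _ (cherries : List Triple)
    (cherry-distinct : ∀ {x y z} → (x , y , z) ∈ˡ cherries → x ≢ y × x ≢ z × y ≢ z) where

    Inside : Subset n → Triple → Set
    Inside W (x , y , z) = x ∈ W × y ∈ W × z ∈ W

    inside? : ∀ W t → Dec (Inside W t)
    inside? W (x , y , z) = (x ∈? W) ×-dec (y ∈? W) ×-dec (z ∈? W)

    -- The three vertices are removed one after another, each removal gaining a factor `q`;
    -- distinctness keeps the others in the set meanwhile.
    𝔼-inside : ∀ {x y z} → x ≢ y × x ≢ z × y ≢ z → q * (q * (q * 𝔼≤ (λ W → 𝟙 (inside? W (x , y , z))))) ≤ Z≤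
    𝔼-inside {x} {y} {z} (x≢y , x≢z , y≢z) = begin
      q * (q * (q * 𝔼≤ (λ W → 𝟙 (inside? W (x , y , z)))))
        ≤⟨ *-monoʳ-≤ q (*-monoʳ-≤ q (≤-trans (*-monoʳ-≤ q (𝔼≤-mono (λ W _ → 𝟙-≤ (inside? W (x , y , z))
             λ (x∈ , y∈ , z∈) → *-mono-≤ (𝟙-≥1 (x ∈? W) x∈)
               (*-mono-≤ (𝟙-≥1 (y ∈? del W x) (∈-del⁺ W x y∈ (≢-sym x≢y)))
                         (𝟙-≥1 (z ∈? del W x) (∈-del⁺ W x z∈ (≢-sym x≢z)))))))
             (𝔼≤-removal x {λ U → 𝟙 (y ∈? U) * 𝟙 (z ∈? U)}))) ⟩
      q * (q * 𝔼≤ (λ W → 𝟙 (y ∈? W) * 𝟙 (z ∈? W)))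
        ≤⟨ *-monoʳ-≤ q (≤-trans (*-monoʳ-≤ q (𝔼≤-mono (λ W _ → 𝟙-*-mono (y ∈? W) λ _ →
             𝟙-mono (z ∈? W) (z ∈? del W y) (λ z∈ → ∈-del⁺ W y z∈ (≢-sym y≢z)))))
             (𝔼≤-removal y {λ U → 𝟙 (z ∈? U)})) ⟩
      q * 𝔼≤ (λ W → 𝟙 (z ∈? W))
        ≤⟨ ≤-trans (*-monoʳ-≤ q (𝔼≤-mono (λ W _ → ≤-reflexive (sym (*-identityʳ _)))))
             (𝔼≤-removal z {λ _ → 1}) ⟩
      Z≤ ∎
      where open ≤-Reasoning

    #inside : Subset n → ℕ
    #inside W = ∑ cherries (λ t → 𝟙 (inside? W t))

    𝔼-#inside : ∀ {r} → 0 < q → length cherries ≤ q * (q * (q * r)) → 𝔼≤ #inside ≤ r * Z≤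
    𝔼-#inside {r} q>0 few = cancel (cancel (cancel (begin
      q * (q * (q * 𝔼≤ #inside))
        ≡⟨ cong (λ e → q * (q * (q * e))) (𝔼≤-∑ cherries (λ t W → 𝟙 (inside? W t))) ⟩
      q * (q * (q * ∑ cherries (λ t → 𝔼≤ (λ W → 𝟙 (inside? W t)))))
        ≡⟨ sym (trans (∑-*ˡ q cherries _) (cong (q *_) (trans (∑-*ˡ q cherries _) (cong (q *_) (∑-*ˡ q cherries _))))) ⟩
      ∑ cherries (λ t → q * (q * (q * 𝔼≤ (λ W → 𝟙 (inside? W t)))))
        ≤⟨ ∑-bound-∈ cherries (λ t∈ → 𝔼-inside (cherry-distinct t∈)) ⟩
      length cherries * Z≤         ≤⟨ *-monoˡ-≤ Z≤ few ⟩
      q * (q * (q * r)) * Z≤       ≡⟨ regroup q r Z≤ ⟩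
      q * (q * (q * (r * Z≤))) ∎)))
      where
      open ≤-Reasoning
      cancel : ∀ {a b} → q * a ≤ q * b → a ≤ b
      cancel = *-cancelˡ-≤ q {{>-nonZero q>0}}
      regroup : ∀ q r z → q * (q * (q * r)) * z ≡ q * (q * (q * (r * z)))
      regroup = solve-∀

    abstract
      full? : ∀ W → Dec (Indep W × R ≤ size W × size W ≤ R)
      full? W = indep? W ×-dec (R ≤? size W) ×-dec (size W ≤? R)

    open Restricted full? using () renaming (𝔼ₚ to 𝔼₌; 𝔼ₚ-*ˡ to 𝔼₌-*; total to Z₌)

    Z≤>0 : 0 < q → 0 < Z≤
    Z≤>0 q>0 = ≤-trans (*-mono-≤ (weight>0 q>0 (Subset.⊥ {n})) (*-mono-≤ (𝟙-≥1 (small? Subset.⊥) small-⊥) (≤-refl {1})))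
      (∑-∈ (λ W → weight W * (𝟙 (small? W) * 1)) (∈-subsets Subset.⊥))
      where
      small-⊥ : Small Subset.⊥
      small-⊥ = (λ { (_ , _ , _ , _ , x∈ , _) → ∉⊥ x∈ }) ,
        ≤-trans (length-⊆ {ys = []} (elems-unique {n} Subset.⊥) (⊥-elim ∘ ∉⊥ ∘ ∈-elems⁻ {n} Subset.⊥)) z≤n

    Z≤-split : Z≤ ≤ Z< + Z₌
    Z≤-split = ≤-trans
      (𝔼-mono (λ W → 𝟙*-≤ (small? W) λ (i , s) → case size W <? R of λ
        { (yes s<) → m≤n⇒m≤n+o _ (*-mono-≤ (𝟙-≥1 (smaller? W) (i , s<)) ≤-refl)
        ; (no s≮)  → m≤n⇒m≤o+n (𝟙 (smaller? W) * 1) (*-mono-≤ (𝟙-≥1 (full? W) (i , ≮⇒≥ s≮ , s)) ≤-refl) }))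
      (≤-reflexive (𝔼-+ (λ W → 𝟙 (smaller? W) * 1) (λ W → 𝟙 (full? W) * 1)))

    -- Deleting the first vertex of every cherry inside `W` destroys all cherries at a cost of at
    -- most 2r vertices, and independence passes to subsets.
    delete-apexes : ∀ {r W} → Indep W → R ≤ size W → #inside W ≤ 2 * r →
      ∃[ S ] (Unique S × R ≤ length S + 2 * r
      × (∀ {x y z w} → x ∈ˡ S → y ∈ˡ S → z ∈ˡ S → w ∈ˡ S → ¬ H x y z w)
      × (∀ {x y z} → (x , y , z) ∈ˡ cherries → x ∈ˡ S → y ∈ˡ S → z ∈ˡ S → ⊥))
    delete-apexes {r} {W} iW full fewW = S , filter⁺ keep? (elems-unique W) ,
      ≤-trans full (≤-trans covered (+-monoʳ-≤ (length S) apexes-few)) ,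
      (λ x∈ y∈ z∈ w∈ e → iW (_ , _ , _ , _ , S⊆W x∈ , S⊆W y∈ , S⊆W z∈ , S⊆W w∈ , e)) ,
      λ t∈ x∈ y∈ z∈ → proj₂ (∈-filter⁻ keep? {xs = elems W} x∈)
        (∈-map⁺ proj₁ (∈-filter⁺ (inside? W) t∈ (S⊆W x∈ , S⊆W y∈ , S⊆W z∈)))
      where
      open DecMembership (_≟_ {n}) using () renaming (_∈?_ to _∈¹?_)
      apexes : List (Fin n)
      apexes = map proj₁ (filter (inside? W) cherries)
      keep? : ∀ x → Dec (x ∉ˡ apexes)
      keep? x = ¬? (x ∈¹? apexes)
      S : List (Fin n)
      S = filter keep? (elems W)
      S⊆W : ∀ {x} → x ∈ˡ S → x ∈ W
      S⊆W x∈ = ∈-elems⁻ W (proj₁ (∈-filter⁻ keep? {xs = elems W} x∈))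
      apexes-few : length apexes ≤ 2 * r
      apexes-few = ≤-trans (≤-reflexive (trans (length-map proj₁ (filter (inside? W) cherries))
        (sym (∑𝟙≡length-filter (inside? W) cherries)))) fewW
      covered : length (elems W) ≤ length S + length apexes
      covered = ≤-trans (length-⊆ (elems-unique W) λ {x} x∈ → case x ∈¹? apexes of λ
        { (yes a) → ∈-++⁺ʳ S a ; (no ¬a) → ∈-++⁺ˡ (∈-filter⁺ keep? x∈ ¬a) })
        (≤-reflexive (length-++ S))

    module _ {M T Y r : ℕ} (q>0 : 0 < q) (growth : ∀ x → x ≤ M → suc q ^ x ≤ T * q ^ x)
      (qY : 2 * R⁶D³ ≤ q * Y) (nM>0 : 0 < n * M)
      (budget : 2 * (M * (T * (suc q * R)) + (q * R³D + (n * R + (R⁴D² + Y)))) ≤ n * M)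
      (few : length cherries ≤ q * (q * (q * r))) where

      -- The factor 2 in `budget` makes the weight below full size at most half of the total.
      Z≤≤2Z₌ : Z≤ ≤ 2 * Z₌
      Z≤≤2Z₌ = +-cancelˡ-≤ Z≤ Z≤ (2 * Z₌) (begin
        Z≤ + Z≤              ≡⟨ cong (Z≤ +_) (sym (+-identityʳ Z≤)) ⟩
        2 * Z≤               ≤⟨ *-monoʳ-≤ 2 Z≤-split ⟩
        2 * (Z< + Z₌)        ≡⟨ *-distribˡ-+ 2 Z< Z₌ ⟩
        2 * Z< + 2 * Z₌      ≤⟨ +-monoˡ-≤ (2 * Z₌) (*-cancelˡ-≤ (n * M) {{>-nonZero nM>0}} (begin
          n * M * (2 * Z<)   ≡⟨ *-comm-middle (n * M) 2 Z< ⟩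
          2 * (n * M * Z<)   ≤⟨ *-monoʳ-≤ 2 (smaller-rare {M} {T} q>0 growth qY) ⟩
          2 * (B * Z≤)       ≡⟨ sym (*-assoc 2 B Z≤) ⟩
          2 * B * Z≤         ≤⟨ *-monoˡ-≤ Z≤ budget ⟩
          n * M * Z≤ ∎)) ⟩
        Z≤ + 2 * Z₌ ∎)
        where
        open ≤-Reasoning
        B : ℕ
        B = M * (T * (suc q * R)) + (q * R³D + (n * R + (R⁴D² + Y)))

      -- The mean number of cherries is at most `r`. Restricting to full-size sets, which carry at
      -- least half of the weight, raises it to at most 2r, and some set does not exceed the mean.
      full-few-cherries : ∃[ W ] (Indep W × R ≤ size W × #inside W ≤ 2 * r)
      full-few-cherries =
        finish (∑-<⇒∃< (subsets n) below)
        where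
        finish : (∃ λ W → weight W * (𝟙 (full? W) * #inside W) < weight W * (𝟙 (full? W) * suc (2 * r))) →
                 ∃[ W ] (Indep W × R ≤ size W × #inside W ≤ 2 * r)
        finish (W , lt) = case 𝟙*-< (full? W) (*-cancelˡ-< (weight W) _ _ lt) of λ
          { ((i , s , _) , few) → W , i , s , ≤-pred few }
        arith : ∀ {a z z′} → a ≤ r * z → z ≤ 2 * z′ → 0 < z → a < suc (2 * r) * z′
        arith {a} {z} {z′} a≤rz z≤2z′ z>0 = begin-strict
          a                 ≤⟨ a≤rz ⟩
          r * z             ≤⟨ *-monoʳ-≤ r z≤2z′ ⟩
          r * (2 * z′)      ≡⟨ trans (*-comm-middle r 2 z′) (sym (*-assoc 2 r z′)) ⟩
          2 * r * z′        <⟨ m<n+m (2 * r * z′) (*-cancelˡ-< 2 0 z′ (<-≤-trans z>0 z≤2z′)) ⟩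
          suc (2 * r) * z′ ∎
          where open ≤-Reasoning
        constant : suc (2 * r) * Z₌ ≡ 𝔼₌ (λ _ → suc (2 * r))
        constant = trans (sym (𝔼₌-* (suc (2 * r)) (λ _ → 1)))
          (𝔼-cong (λ W → cong (𝟙 (full? W) *_) (*-identityʳ (suc (2 * r)))))
        -- Comparing with 2r + 1 makes the inequality strict, and for an integer count this still
        -- yields at most 2r.
        below : 𝔼₌ #inside < 𝔼₌ (λ _ → suc (2 * r))
        below = subst (𝔼₌ #inside <_) constant
          (≤-<-trans (𝔼-mono (λ W → *-monoˡ-≤ (#inside W) (𝟙-mono (full? W) (small? W) (λ (i , _ , s) → i , s))))
            (arith (𝔼-#inside q>0 few) Z≤≤2Z₌ (Z≤>0 q>0)))

      cherry-free : ∃[ S ] (Unique S × R ≤ length S + 2 * r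
        × (∀ {x y z w} → x ∈ˡ S → y ∈ˡ S → z ∈ˡ S → w ∈ˡ S → ¬ H x y z w)
        × (∀ {x y z} → (x , y , z) ∈ˡ cherries → x ∈ˡ S → y ∈ˡ S → z ∈ˡ S → ⊥))
      cherry-free = let W , i , s , few = full-few-cherries in delete-apexes {r} i s few

-- Edge-colourings

module Colouring {n : ℕ} (χ : Coloring n) where

  κ : Fin n → Fin n → ℕ
  κ = edgeCol χ

  κ-sym : ∀ {u v} → u ≢ v → κ u v ≡ κ v u
  κ-sym {u} {v} u≢v with u Fin.<? v | v Fin.<? u
  ... | yes u<v | yes v<u = contradiction v<u (Finₚ.<-asym u<v)
  ... | yes _   | no _    = refl
  ... | no _    | yes _   = refl
  ... | no u≮v  | no v≮u  = contradiction (Finₚ.≤-antisym (≮⇒≥ v≮u) (≮⇒≥ u≮v)) u≢v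

  inNb? : ∀ u α w → Dec (w ≢ u × κ u w ≡ α)
  inNb? u α w = ¬? (w ≟ u) ×-dec (κ u w ℕ≟ α)

  nb : Fin n → ℕ → List (Fin n)
  nb u α = filter (inNb? u α) (allFin n)

  ∈-nb⁺ : ∀ {u α w} → w ≢ u → κ u w ≡ α → w ∈ˡ nb u α
  ∈-nb⁺ {u} {α} w≢u eq = ∈-filter⁺ (inNb? u α) (∈-allFin _) (w≢u , eq)

  ∈-nb⁻ : ∀ {u α w} → w ∈ˡ nb u α → w ≢ u × κ u w ≡ α
  ∈-nb⁻ {u} {α} w∈ = proj₂ (∈-filter⁻ (inNb? u α) {xs = allFin n} w∈)

  nb-unique : ∀ u α → Unique (nb u α)
  nb-unique u α = filter⁺ (inNb? u α) (allFin⁺ n)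

  RainbowSet : List (Fin n) → Set
  RainbowSet S = ∀ {x y z w} → x ∈ˡ S → y ∈ˡ S → z ∈ˡ S → w ∈ˡ S → x ≢ y → z ≢ w →
    κ x y ≡ κ z w → (x ≡ z × y ≡ w) ⊎ (x ≡ w × y ≡ z)

  rainbowSet⇒rainbow : ∀ {S k} → Unique S → RainbowSet S → k ≤ length S →
                       Σ (Embedding k n) λ e → Rainbow χ (proj₁ e)
  rainbowSet⇒rainbow uS rb k≤ with embed uS k≤
  ... | (f , inj) , f∈ = (f , inj) , λ i j i′ j′ i<j i′<j′ eq →
    case rb (f∈ i) (f∈ j) (f∈ i′) (f∈ j′) (Finₚ.<⇒≢ i<j ∘ inj) (Finₚ.<⇒≢ i′<j′ ∘ inj) eq of λ
      { (inj₁ (p , q)) → inj p , inj q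
      ; (inj₂ (p , q)) → contradiction (subst₂ Fin._<_ (inj p) (inj q) i<j) (Finₚ.<-asym i′<j′) }

  Distinct : Fin n → Fin n → Fin n → Fin n → Set
  Distinct x y z w = x ≢ y × x ≢ z × x ≢ w × y ≢ z × y ≢ w × z ≢ w

  -- The three alternatives are the three perfect matchings of the four vertices, so the relation is
  -- symmetric.
  Repeated : Fin n → Fin n → Fin n → Fin n → Set
  Repeated x y z w = Distinct x y z w × (κ x y ≡ κ z w ⊎ κ x z ≡ κ y w ⊎ κ x w ≡ κ y z)

  module _ {d : ℕ} (bounded : ∀ u α → length (nb u α) ≤ d) where

    -- Given x, y, z, the missing vertex is matched with one of them in the colour of the edge
    -- between the other two, and each choice leaves at most `d` vertices.
    repeated : Hypergraph n (3 * d)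
    repeated = record
      { H = Repeated
      ; H? = λ x y z w → (¬? (x ≟ y) ×-dec ¬? (x ≟ z) ×-dec ¬? (x ≟ w) ×-dec
                          ¬? (y ≟ z) ×-dec ¬? (y ≟ w) ×-dec ¬? (z ≟ w)) ×-dec
          ((κ x y ℕ≟ κ z w) ⊎-dec (κ x z ℕ≟ κ y w) ⊎-dec (κ x w ℕ≟ κ y z))
      ; swap₁₂ = λ ((a , b , c , d , e , f) , h) → (≢-sym a , d , e , b , c , f) ,
          (case h of λ { (inj₁ p) → inj₁ (trans (κ-sym (≢-sym a)) p)
                       ; (inj₂ (inj₁ p)) → inj₂ (inj₂ (sym p))
                       ; (inj₂ (inj₂ p)) → inj₂ (inj₁ (sym p)) })
      ; swap₂₃ = λ ((a , b , c , d , e , f) , h) → (b , a , c , ≢-sym d , f , e) ,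
          (case h of λ { (inj₁ p) → inj₂ (inj₁ p)
                       ; (inj₂ (inj₁ p)) → inj₁ p
                       ; (inj₂ (inj₂ p)) → inj₂ (inj₂ (trans p (κ-sym d))) })
      ; swap₃₄ = λ ((a , b , c , d , e , f) , h) → (a , c , b , e , d , ≢-sym f) ,
          (case h of λ { (inj₁ p) → inj₁ (trans p (κ-sym f))
                       ; (inj₂ (inj₁ p)) → inj₂ (inj₂ p)
                       ; (inj₂ (inj₂ p)) → inj₂ (inj₁ p) })
      ; distinct₁₂ = λ ((a , _) , _) → a
      ; ext = ext
      ; ext-complete = λ {x} {y} {z} ((_ , _ , c , _ , e , f) , h) → case h of λ
          { (inj₁ p)        → ∈-++⁺ˡ (∈-nb⁺ (≢-sym f) (sym p))
          ; (inj₂ (inj₁ p)) → ∈-++⁺ʳ (nb z (κ x y)) (∈-++⁺ˡ (∈-nb⁺ (≢-sym e) (sym p)))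
          ; (inj₂ (inj₂ p)) → ∈-++⁺ʳ (nb z (κ x y)) (∈-++⁺ʳ (nb y (κ x z)) (∈-++⁺ˡ (∈-nb⁺ (≢-sym c) p))) }
      ; ext-length = λ x y z → ≤-trans (≤-reflexive (length-++ (nb z (κ x y))))
          (+-mono-≤ (bounded z _) (≤-trans (≤-reflexive (length-++ (nb y (κ x z))))
            (+-mono-≤ (bounded y _) (≤-trans (≤-reflexive (length-++ (nb x (κ y z)))) (+-mono-≤ (bounded x _) z≤n)))))
      }
      where
      ext : Fin n → Fin n → Fin n → List (Fin n)
      ext x y z = nb z (κ x y) ++ nb y (κ x z) ++ nb x (κ y z) ++ []

    cherry? : (t : Fin n × Fin n × Fin n) → let x , y , z = t in Dec (x ≢ y × x ≢ z × y ≢ z)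
    cherry? (x , y , z) = ¬? (x ≟ y) ×-dec ¬? (x ≟ z) ×-dec ¬? (y ≟ z)

    -- A cherry is listed with its apex first; the third vertex is one of at most `d` neighbours of
    -- the apex in the colour of the first edge.
    cherryCandidates cherries : List (Fin n × Fin n × Fin n)
    cherryCandidates = allFin n >>= λ x → allFin n >>= λ y → nb x (κ x y) >>= λ z → (x , y , z) ∷ []
    cherries = filter cherry? cherryCandidates

    cherries-length : length cherries ≤ n * (n * (d * 1))
    cherries-length = ≤-trans (length-filter cherry? cherryCandidates)
      (length-bind {xs = allFin n} _ |V| λ x → length-bind {xs = allFin n} _ |V| λ y →
       length-bind {xs = nb x (κ x y)} _ (bounded x (κ x y)) λ _ → ≤-refl)
      where
      |V| : length (allFin n) ≤ n
      |V| = ≤-reflexive (length-tabulate id)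

    ∈-cherries : ∀ {x y z} → x ≢ y → x ≢ z → y ≢ z → κ x y ≡ κ x z → (x , y , z) ∈ˡ cherries
    ∈-cherries {x} {y} {z} x≢y x≢z y≢z eq = ∈-filter⁺ cherry? candidate (x≢y , x≢z , y≢z)
      where
      candidate : (x , y , z) ∈ˡ cherryCandidates
      candidate = ∈-bind _ (∈-allFin x) (∈-bind _ (∈-allFin y)
        (∈-bind _ (∈-nb⁺ (≢-sym x≢z) (sym eq)) (here refl)))

    -- Two different edges of one colour are either disjoint, giving an edge of the hypergraph, or
    -- share a vertex, giving a cherry with that apex.
    rainbow-set : ∀ {S} →
      (∀ {x y z w} → x ∈ˡ S → y ∈ˡ S → z ∈ˡ S → w ∈ˡ S → ¬ Repeated x y z w) →
      (∀ {x y z} → (x , y , z) ∈ˡ cherries → x ∈ˡ S → y ∈ˡ S → z ∈ˡ S → ⊥) → RainbowSet S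
    rainbow-set ¬rep ¬ch {x} {y} {z} {w} x∈ y∈ z∈ w∈ x≢y z≢w eq with x ≟ z | x ≟ w | y ≟ z | y ≟ w
    ... | yes refl | _ | _ | yes refl = inj₁ (refl , refl)
    ... | yes refl | _ | _ | no y≢w   = ⊥-elim (¬ch (∈-cherries x≢y z≢w y≢w eq) x∈ y∈ w∈)
    ... | _ | yes refl | yes refl | _ = inj₂ (refl , refl)
    ... | _ | yes refl | no y≢z | _   =
      ⊥-elim (¬ch (∈-cherries x≢y (≢-sym z≢w) y≢z (trans eq (κ-sym z≢w))) x∈ y∈ z∈)
    ... | no x≢z | no x≢w | yes refl | _ =
      ⊥-elim (¬ch (∈-cherries (≢-sym x≢y) z≢w x≢w (trans (κ-sym (≢-sym x≢y)) eq)) y∈ x∈ w∈)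
    ... | no x≢z | no x≢w | no y≢z | yes refl =
      ⊥-elim (¬ch (∈-cherries (≢-sym x≢y) (≢-sym z≢w) x≢z
        (trans (κ-sym (≢-sym x≢y)) (trans eq (κ-sym z≢w)))) y∈ x∈ z∈)
    ... | no x≢z | no x≢w | no y≢z | no y≢w =
      ⊥-elim (¬rep x∈ y∈ z∈ w∈ ((x≢y , x≢z , x≢w , y≢z , y≢w , z≢w) , inj₁ eq))

    rainbow-clique : ∀ {r q M T Y} → 0 < q → (∀ x → x ≤ M → suc q ^ x ≤ T * q ^ x) → 0 < n * M →
      let open HardCore repeated (3 * r) q in
      2 * R⁶D³ ≤ q * Y →
      2 * (M * (T * (suc q * (3 * r))) + (q * R³D + (n * (3 * r) + (R⁴D² + Y)))) ≤ n * M →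
      n * (n * (d * 1)) ≤ q * (q * (q * r)) →
      Σ (Embedding r n) λ e → Rainbow χ (proj₁ e)
    rainbow-clique {r} {q} {M} {T} {Y} q>0 growth nM>0 qY budget few =
      -- The choice R = 3r leaves `r` vertices after at most 2r deletions.
      let S , uS , big , ¬rep , ¬ch = cherry-free cherries (λ t∈ → proj₂ (∈-filter⁻ cherry? {xs = cherryCandidates} t∈))
                                      {M} {T} {Y} {r} q>0 growth qY nM>0 budget (≤-trans cherries-length few)
      in rainbowSet⇒rainbow uS (rainbow-set ¬rep ¬ch) (+-cancelʳ-≤ (2 * r) r (length S) big)
      where open FewCherries repeated (3 * r) q

-- Numerical parameters

-- A form of Bernoulli's inequality: (1 + 1/q)^j ≤ q / (q - j), with i = q - j. The induction uses
-- (q + 1) i ≤ q (i + 1).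
pow-gap : ∀ q i j → i + j ≡ q → suc q ^ j * i ≤ q ^ j * q
pow-gap q i zero    eq = *-monoʳ-≤ 1 (≤-trans (m≤m+n i 0) (≤-reflexive eq))
pow-gap q i (suc j) eq = begin
  suc q * suc q ^ j * i      ≡⟨ regroup (suc q) (suc q ^ j) i ⟩
  suc q ^ j * (i + q * i)    ≤⟨ *-monoʳ-≤ (suc q ^ j) (+-monoˡ-≤ (q * i) (≤-trans (m≤m+n i (suc j)) (≤-reflexive eq))) ⟩
  suc q ^ j * (q + q * i)    ≡⟨ cong (suc q ^ j *_) (sym (*-suc q i)) ⟩
  suc q ^ j * (q * suc i)    ≡⟨ *-comm-middle (suc q ^ j) q (suc i) ⟩
  q * (suc q ^ j * suc i)    ≤⟨ *-monoʳ-≤ q (pow-gap q (suc i) j (trans (sym (+-suc i j)) eq)) ⟩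
  q * (q ^ j * q)            ≡⟨ sym (*-assoc q (q ^ j) q) ⟩
  q * q ^ j * q ∎
  where
  open ≤-Reasoning
  regroup : ∀ a b c → a * b * c ≡ b * (a * c)
  regroup = solve-∀

pow-double : ∀ h → 0 < h → suc (2 * h) ^ h ≤ 2 * (2 * h) ^ h
pow-double h h>0 = *-cancelʳ-≤ _ _ h {{>-nonZero h>0}} (≤-trans
  (pow-gap (2 * h) h h (cong (h +_) (sym (+-identityʳ h))))
  (≤-reflexive (regroup ((2 * h) ^ h) h)))
  where
  regroup : ∀ a h → a * (2 * h) ≡ 2 * a * h
  regroup = solve-∀

^-distribʳ-* : ∀ k m n → (m * n) ^ k ≡ m ^ k * n ^ k
^-distribʳ-* zero    m n = refl
^-distribʳ-* (suc k) m n = trans (cong (m * n *_) (^-distribʳ-* k m n)) (regroup m n (m ^ k) (n ^ k))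
  where
  regroup : ∀ a b c d → a * b * (c * d) ≡ a * c * (b * d)
  regroup = solve-∀

-- By `pow-double`, (1 + 1/q)^h ≤ 2 for q = 2h; the L-th power of this settles x = hL, and smaller
-- exponents are padded with `y` further factors.
growth : ∀ h L → 0 < h → ∀ x → x ≤ h * L → suc (2 * h) ^ x ≤ 2 ^ L * (2 * h) ^ x
growth h L h>0 x x≤ = *-cancelʳ-≤ _ _ (q ^ y) {{m^n≢0 q y {{>-nonZero (*-mono-< {0} {2} (s≤s z≤n) h>0)}}}} (begin
  suc q ^ x * q ^ y        ≤⟨ *-monoʳ-≤ (suc q ^ x) (^-monoˡ-≤ y (n≤1+n q)) ⟩
  suc q ^ x * suc q ^ y    ≡⟨ sym (^-distribˡ-+-* (suc q) x y) ⟩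
  suc q ^ (x + y)          ≡⟨ cong (suc q ^_) (m+[n∸m]≡n x≤) ⟩
  suc q ^ (h * L)          ≡⟨ sym (^-*-assoc (suc q) h L) ⟩
  (suc q ^ h) ^ L          ≤⟨ ^-monoˡ-≤ L (pow-double h h>0) ⟩
  (2 * q ^ h) ^ L          ≡⟨ ^-distribʳ-* L 2 (q ^ h) ⟩
  2 ^ L * (q ^ h) ^ L      ≡⟨ cong (2 ^ L *_) (^-*-assoc q h L) ⟩
  2 ^ L * q ^ (h * L)      ≡⟨ cong (λ z → 2 ^ L * q ^ z) (sym (m+[n∸m]≡n x≤)) ⟩
  2 ^ L * q ^ (x + y)      ≡⟨ cong (2 ^ L *_) (^-distribˡ-+-* q x y) ⟩
  2 ^ L * (q ^ x * q ^ y)  ≡⟨ sym (*-assoc (2 ^ L) _ _) ⟩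
  2 ^ L * q ^ x * q ^ y ∎)
  where
  open ≤-Reasoning
  q y : ℕ
  q = 2 * h
  y = h * L ∸ x

2^log≤ : ∀ n → 0 < n → 2 ^ ⌊log₂ n ⌋ ≤ n
2^log≤ n = go n _
  where
  go : ∀ n (rec : Acc _<_ n) → 0 < n → 2 ^ ⌊log2⌋ n rec ≤ n
  go 1             _         _ = ≤-refl
  go (suc (suc n)) (acc rec) _ = begin
    2 * 2 ^ ⌊log2⌋ (suc ⌊ n /2⌋) _   ≤⟨ *-monoʳ-≤ 2 (go (suc ⌊ n /2⌋) _ (s≤s z≤n)) ⟩
    2 * suc ⌊ n /2⌋                  ≡⟨ cong (λ m → suc ⌊ n /2⌋ + m) (+-identityʳ (suc ⌊ n /2⌋)) ⟩
    suc ⌊ n /2⌋ + suc ⌊ n /2⌋        ≡⟨ +-suc (suc ⌊ n /2⌋) ⌊ n /2⌋ ⟩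
    2 + (⌊ n /2⌋ + ⌊ n /2⌋)          ≤⟨ +-monoʳ-≤ 2 (≤-trans (+-monoʳ-≤ ⌊ n /2⌋ (⌊n/2⌋≤⌈n/2⌉ n)) (≤-reflexive (⌊n/2⌋+⌈n/2⌉≡n n))) ⟩
    2 + n ∎
    where open ≤-Reasoning

n≤2^n : ∀ n → n ≤ 2 ^ n
n≤2^n zero    = z≤n
n≤2^n (suc n) = begin
  1 + n              ≤⟨ +-mono-≤ (m^n>0 2 n) (n≤2^n n) ⟩
  2 ^ n + 2 ^ n      ≡⟨ cong (2 ^ n +_) (sym (+-identityʳ _)) ⟩
  2 * 2 ^ n ∎
  where open ≤-Reasoning

-- Scales derived from r

module Scales (r : ℕ) (r≥2 : 2 ≤ r) where

  -- `L` is about a quarter of log₂ r, hence `t` is of order r^(1/4), and `g` is r²/(Lt) rounded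
  -- down. The quarter keeps t⁴ of order `r`, which gives rt² = O(g).
  ℓ₂ L t Lt g : ℕ
  ℓ₂ = ⌊log₂ r ⌋
  L = suc (ℓ₂ DivMod./ 4)
  t = 2 ^ L
  Lt = L * t

  Lt>0 : 0 < Lt
  Lt>0 = *-mono-< {0} {L} {0} {t} (s≤s z≤n) (m^n>0 2 L)

  g = DivMod._/_ (r * r) Lt {{>-nonZero Lt>0}}

  r>0 : 0 < r
  r>0 = ≤-trans (s≤s z≤n) r≥2

  ℓ₂>0 : 0 < ℓ₂
  ℓ₂>0 = ⌊log₂⌋-mono-≤ r≥2

  ℓ₂≤4L : ℓ₂ ≤ 4 * L
  ℓ₂≤4L = begin
    ℓ₂                                        ≡⟨ DivMod.m≡m%n+[m/n]*n ℓ₂ 4 ⟩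
    ℓ₂ DivMod.% 4 + ℓ₂ DivMod./ 4 * 4         ≤⟨ +-monoˡ-≤ _ (<⇒≤ (DivMod.m%n<n ℓ₂ 4)) ⟩
    4 + ℓ₂ DivMod./ 4 * 4                     ≡⟨ *-comm L 4 ⟩
    4 * L ∎
    where open ≤-Reasoning

  L≤t : L ≤ t
  L≤t = n≤2^n L

  t≤r : t ≤ r
  t≤r = ≤-trans (^-monoʳ-≤ 2 (DivMod.m/n<m ℓ₂ 4 {{>-nonZero ℓ₂>0}} (s≤s (s≤s z≤n)))) (2^log≤ r r>0)

  -- The successor in `L` contributes one factor 2 to `t`, hence 16 to its fourth power.
  t⁴≤16r : t * t * (t * t) ≤ 16 * r
  t⁴≤16r = begin
    t * t * (t * t)                     ≡⟨ regroup (2 ^ k) ⟩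
    16 * (2 ^ k * 2 ^ k * (2 ^ k * 2 ^ k))
      ≡⟨ cong (16 *_) (sym (trans (^-distribˡ-+-* 2 (k + k) (k + k))
           (cong₂ _*_ (^-distribˡ-+-* 2 k k) (^-distribˡ-+-* 2 k k)))) ⟩
    16 * 2 ^ (k + k + (k + k))          ≤⟨ *-monoʳ-≤ 16 (^-monoʳ-≤ 2 (≤-trans (≤-reflexive (four k)) (DivMod.m/n*n≤m ℓ₂ 4))) ⟩
    16 * 2 ^ ℓ₂                         ≤⟨ *-monoʳ-≤ 16 (2^log≤ r r>0) ⟩
    16 * r ∎
    where
    open ≤-Reasoning
    k : ℕ
    k = ℓ₂ DivMod./ 4
    regroup : ∀ a → 2 * a * (2 * a) * (2 * a * (2 * a)) ≡ 16 * (a * a * (a * a))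
    regroup = solve-∀
    four : ∀ k → k + k + (k + k) ≡ k * 4
    four = solve-∀

  Ltg≤r² : Lt * g ≤ r * r
  Ltg≤r² = ≤-trans (≤-reflexive (*-comm Lt g)) (DivMod.m/n*n≤m (r * r) Lt {{>-nonZero Lt>0}})

  g>0 : 0 < g
  g>0 = DivMod.m≥n⇒m/n>0 {r * r} {Lt} {{>-nonZero Lt>0}} (*-mono-≤ (≤-trans L≤t t≤r) t≤r)

  -- The remainder of the division is below Lt, which is at most g Lt as `g` is positive, so
  -- rounding loses at most a factor 2.
  r²≤2Ltg : r * r ≤ 2 * (Lt * g)
  r²≤2Ltg = begin
    r * r              ≡⟨ DivMod.m≡m%n+[m/n]*n (r * r) Lt {{nz}} ⟩
    DivMod._%_ (r * r) Lt {{nz}} + g * Lt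
      ≤⟨ +-monoˡ-≤ (g * Lt) (≤-trans (<⇒≤ (DivMod.m%n<n (r * r) Lt {{nz}})) (m≤n*m Lt g {{>-nonZero g>0}})) ⟩
    g * Lt + g * Lt    ≡⟨ regroup g Lt ⟩
    2 * (Lt * g) ∎
    where
    open ≤-Reasoning
    nz : NonZero Lt
    nz = >-nonZero Lt>0
    regroup : ∀ g l → g * l + g * l ≡ 2 * (l * g)
    regroup = solve-∀

  r²≤2t²g : r * r ≤ 2 * (t * t * g)
  r²≤2t²g = ≤-trans r²≤2Ltg (*-monoʳ-≤ 2 (*-monoˡ-≤ g (*-monoˡ-≤ t L≤t)))

  rt²≤32g : r * (t * t) ≤ 32 * g
  rt²≤32g = *-cancelˡ-≤ r {{>-nonZero r>0}} (begin
    r * (r * (t * t))              ≡⟨ sym (*-assoc r r (t * t)) ⟩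
    r * r * (t * t)                ≤⟨ *-monoˡ-≤ (t * t) r²≤2t²g ⟩
    2 * (t * t * g) * (t * t)      ≡⟨ regroup (t * t) g ⟩
    2 * g * (t * t * (t * t))      ≤⟨ *-monoʳ-≤ (2 * g) t⁴≤16r ⟩
    2 * g * (16 * r)               ≡⟨ regroup′ g r ⟩
    r * (32 * g) ∎)
    where
    open ≤-Reasoning
    regroup : ∀ s g → 2 * (s * g) * s ≡ 2 * g * (s * s)
    regroup = solve-∀
    regroup′ : ∀ g r → 2 * g * (16 * r) ≡ r * (32 * g)
    regroup′ = solve-∀

  r≤32g : r ≤ 32 * g
  r≤32g = ≤-trans (m≤m*n r (t * t) {{>-nonZero (*-mono-< {0} {t} {0} {t} (m^n>0 2 L) (m^n>0 2 L))}}) rt²≤32g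

  r³≤64g² : r * (r * r) ≤ 64 * (g * g)
  r³≤64g² = *-cancelˡ-≤ r {{>-nonZero r>0}} (begin
    r * (r * (r * r))                      ≡⟨ sym (*-assoc r r (r * r)) ⟩
    r * r * (r * r)                        ≤⟨ *-mono-≤ r²≤2t²g r²≤2t²g ⟩
    2 * (t * t * g) * (2 * (t * t * g))    ≡⟨ regroup (t * t) g ⟩
    4 * (g * g) * (t * t * (t * t))        ≤⟨ *-monoʳ-≤ (4 * (g * g)) t⁴≤16r ⟩
    4 * (g * g) * (16 * r)                 ≡⟨ regroup′ (g * g) r ⟩
    r * (64 * (g * g)) ∎)
    where
    open ≤-Reasoning
    regroup : ∀ s g → 2 * (s * g) * (2 * (s * g)) ≡ 4 * (g * g) * (s * s)
    regroup = solve-∀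
    regroup′ : ∀ g r → 4 * g * (16 * r) ≡ r * (64 * g)
    regroup′ = solve-∀

-- Choice of the parameters and the five error terms

module Budget (B : ℕ) (B≥ : 32400 ≤ B) (r : ℕ) (r≥2 : 2 ≤ r) (d : ℕ) (d>0 : 0 < d) where

  open Scales r r≥2

  -- With q = 2h and M = hL the factor (1 + 1/q)^M is at most 2^L = t. Up to a factor 2, `N` is 90 B
  -- d r³/L. Its 90 = 10 · 3 · 3 comes from `light-cost`, and `Y` is chosen for `determined-fits`.
  h q M N Y R D : ℕ
  h = B * (d * g)
  q = 2 * h
  M = h * L
  N = 90 * (B * (d * (r * (t * g))))
  Y = B * (d * d * (r * (r * r) * g))
  R = 3 * r
  D = 3 * d

  constant : ∀ k {_ : True (k ≤? 32400)} → k ≤ B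
  constant k {k≤} = ≤-trans (toWitness k≤) B≥

  B>0 : 0 < B
  B>0 = constant 1

  h>0 : 0 < h
  h>0 = *-mono-< {0} {B} {0} B>0 (*-mono-< {0} {d} {0} d>0 g>0)

  N>0 : 0 < N
  N>0 = *-mono-< {0} {90} {0} (s≤s z≤n) (*-mono-< {0} {B} {0} B>0 (*-mono-< {0} {d} {0} d>0
    (*-mono-< {0} {r} {0} r>0 (*-mono-< {0} {t} {0} (m^n>0 2 L) g>0))))

  NM>0 : 0 < N * M
  NM>0 = *-mono-< {0} {N} {0} N>0 (*-mono-< {0} {h} {0} h>0 (s≤s z≤n))

  open ≤-Reasoning

  -- Each of the five error terms is kept to a tenth of N M, so that twice their sum fits. Here q +
  -- 1 ≤ 3h, and `N` is chosen to make the rest an equality.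
  light-cost : 10 * (M * (t * (suc q * R))) ≤ N * M
  light-cost = begin
    10 * (M * (t * (suc q * R)))      ≤⟨ *-monoʳ-≤ 10 (*-monoʳ-≤ M (*-monoʳ-≤ t (*-monoˡ-≤ R (+-monoˡ-≤ q h>0)))) ⟩
    10 * (M * (t * ((h + q) * R)))    ≡⟨ regroup M t B d g r ⟩
    N * M ∎
    where
    regroup : ∀ M t B d g r → 10 * (M * (t * ((B * (d * g) + 2 * (B * (d * g))) * (3 * r))))
              ≡ 90 * (B * (d * (r * (t * g)))) * M
    regroup = solve-∀

  -- The logarithm is gained here: the threshold `M` must exceed the mean number of blockers, and
  -- its factor `L` enters through r² ≤ 2Ltg.
  blocker-cost : 10 * (q * (R * (R * (R * (D * 1))))) ≤ N * M
  blocker-cost = begin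
    10 * (q * (R * (R * (R * (D * 1)))))         ≡⟨ regroup h d r ⟩
    18 * (90 * (h * d * r)) * (r * r)            ≤⟨ *-monoʳ-≤ (18 * (90 * (h * d * r))) r²≤2Ltg ⟩
    18 * (90 * (h * d * r)) * (2 * (Lt * g))     ≡⟨ regroup′ h d r L t g ⟩
    36 * (90 * (d * (r * (t * g))) * M)          ≤⟨ *-monoˡ-≤ (90 * (d * (r * (t * g))) * M) (constant 36) ⟩
    B * (90 * (d * (r * (t * g))) * M)           ≡⟨ regroup″ B (d * (r * (t * g))) M ⟩
    N * M ∎
    where
    regroup : ∀ h d r → 10 * (2 * h * (3 * r * (3 * r * (3 * r * (3 * d * 1))))) ≡ 18 * (90 * (h * d * r)) * (r * r)
    regroup = solve-∀
    regroup′ : ∀ h d r L t g → 18 * (90 * (h * d * r)) * (2 * (L * t * g)) ≡ 36 * (90 * (d * (r * (t * g))) * (h * L))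
    regroup′ = solve-∀
    regroup″ : ∀ B x M → B * (90 * x * M) ≡ 90 * (B * x) * M
    regroup″ = solve-∀

  size-cost : 10 * (N * R) ≤ N * M
  size-cost = begin
    10 * (N * R)          ≡⟨ regroup N r ⟩
    N * (30 * r)          ≤⟨ *-monoʳ-≤ N (*-monoʳ-≤ 30 r≤32g) ⟩
    N * (30 * (32 * g))   ≡⟨ cong (N *_) (sym (*-assoc 30 32 g)) ⟩
    N * (960 * g)         ≤⟨ *-monoʳ-≤ N (*-mono-≤ (constant 960) (m≤n*m g d {{>-nonZero d>0}})) ⟩
    N * h                 ≤⟨ *-monoʳ-≤ N (m≤m*n h L) ⟩
    N * M ∎
    where
    regroup : ∀ N r → 10 * (N * (3 * r)) ≡ N * (30 * r)
    regroup = solve-∀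

  -- N M contains `B` twice, so one `B` can pay for a numerical constant `k`.
  B²-bound : ∀ k {_ : True (k ≤? 32400)} → 90 * k * B * (d * d * r * g * (Lt * g)) ≤ N * M
  B²-bound k {k≤} = begin
    90 * k * B * (d * d * r * g * (Lt * g))   ≤⟨ *-monoˡ-≤ (d * d * r * g * (Lt * g))
                                                   (*-monoˡ-≤ B (*-monoʳ-≤ 90 (constant k {k≤}))) ⟩
    90 * B * B * (d * d * r * g * (Lt * g))   ≡⟨ regroup B d r g L t ⟩
    N * M ∎
    where
    regroup : ∀ B d r g L t → 90 * B * B * (d * d * r * g * (L * t * g))
              ≡ 90 * (B * (d * (r * (t * g)))) * (B * (d * g) * L)
    regroup = solve-∀

  coincident-cost : 10 * (R * (R * (R * (R * (D * (D * 1)))))) ≤ N * M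
  coincident-cost = begin
    10 * (R * (R * (R * (R * (D * (D * 1))))))            ≡⟨ regroup r d ⟩
    90 * 81 * (d * d * r * r) * (r * r)                   ≤⟨ *-mono-≤ (*-monoʳ-≤ (90 * 81) (*-monoʳ-≤ (d * d * r) r≤32g)) r²≤2Ltg ⟩
    90 * 81 * (d * d * r * (32 * g)) * (2 * (Lt * g))     ≡⟨ regroup′ (90 * 81) d r g (Lt * g) ⟩
    90 * 81 * 64 * (d * d * r * g * (Lt * g))             ≤⟨ *-monoˡ-≤ (d * d * r * g * (Lt * g)) (*-monoʳ-≤ (90 * 81) (constant 64)) ⟩
    90 * 81 * B * (d * d * r * g * (Lt * g))              ≤⟨ B²-bound 81 ⟩
    N * M ∎
    where
    regroup : ∀ r d → 10 * (3 * r * (3 * r * (3 * r * (3 * r * (3 * d * (3 * d * 1)))))) ≡ 90 * 81 * (d * d * r * r) * (r * r)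
    regroup = solve-∀
    regroup′ : ∀ c d r g x → c * (d * d * r * (32 * g)) * (2 * x) ≡ c * 64 * (d * d * r * g * x)
    regroup′ = solve-∀

  determined-cost : 10 * Y ≤ N * M
  determined-cost = begin
    10 * Y                                               ≡⟨ regroup B d r g ⟩
    10 * B * (d * d * r * g) * (r * r)                   ≤⟨ *-monoʳ-≤ (10 * B * (d * d * r * g)) r²≤2Ltg ⟩
    10 * B * (d * d * r * g) * (2 * (Lt * g))            ≡⟨ regroup′ B (d * d * r * g) (Lt * g) ⟩
    20 * (B * (d * d * r * g * (Lt * g)))                ≤⟨ *-monoˡ-≤ (B * (d * d * r * g * (Lt * g))) (toWitness {a? = 20 ≤? 90} _) ⟩
    90 * (B * (d * d * r * g * (Lt * g)))                ≡⟨ sym (*-assoc 90 B _) ⟩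
    90 * B * (d * d * r * g * (Lt * g))                  ≤⟨ B²-bound 1 ⟩
    N * M ∎
    where
    regroup : ∀ B d r g → 10 * (B * (d * d * (r * (r * r) * g))) ≡ 10 * B * (d * d * r * g) * (r * r)
    regroup = solve-∀
    regroup′ : ∀ B x y → 10 * B * x * (2 * y) ≡ 20 * (B * (x * y))
    regroup′ = solve-∀

  budget : 2 * (M * (t * (suc q * R)) + (q * (R * (R * (R * (D * 1))))
                + (N * R + (R * (R * (R * (R * (D * (D * 1))))) + Y)))) ≤ N * M
  budget = *-cancelˡ-≤ 5 (begin
    5 * (2 * (a + (b + (c + (e + Y)))))                      ≡⟨ regroup a b c e Y ⟩
    10 * a + (10 * b + (10 * c + (10 * e + 10 * Y)))         ≤⟨ +-mono-≤ light-cost (+-mono-≤ blocker-cost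
                                                                 (+-mono-≤ size-cost (+-mono-≤ coincident-cost determined-cost))) ⟩
    N * M + (N * M + (N * M + (N * M + N * M)))              ≡⟨ regroup′ (N * M) ⟩
    5 * (N * M) ∎)
    where
    a b c e : ℕ
    a = M * (t * (suc q * R))
    b = q * (R * (R * (R * (D * 1))))
    c = N * R
    e = R * (R * (R * (R * (D * (D * 1)))))
    regroup : ∀ a b c e y → 5 * (2 * (a + (b + (c + (e + y))))) ≡ 10 * a + (10 * b + (10 * c + (10 * e + 10 * y)))
    regroup = solve-∀
    regroup′ : ∀ x → x + (x + (x + (x + x))) ≡ 5 * x
    regroup′ = solve-∀

  determined-fits : 2 * (R * (R * (R * (R * (R * (R * (D * (D * (D * 1))))))))) ≤ q * Y
  determined-fits = begin
    2 * (R * (R * (R * (R * (R * (R * (D * (D * (D * 1)))))))))     ≡⟨ regroup 3 r d ⟩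
    2 * (81 * 243 * (d * d * d * (r * (r * r)))) * (r * (r * r))    ≤⟨ *-monoʳ-≤ (2 * (81 * 243 * (d * d * d * (r * (r * r))))) r³≤64g² ⟩
    2 * (81 * 243 * (d * d * d * (r * (r * r)))) * (64 * (g * g))   ≡⟨ regroup′ 81 243 (d * d * d * (r * (r * r))) (g * g) ⟩
    -- The constant 3⁹ · 64 is split into 81 · 64 and 243, one for the `B` in `q` and one for the
    -- `B` in `Y`.
    2 * (81 * 64 * (243 * (d * d * d * (r * (r * r)) * (g * g))))      ≤⟨ *-monoʳ-≤ 2 (*-mono-≤ (constant 5184)
                                                                         (*-monoˡ-≤ (d * d * d * (r * (r * r)) * (g * g)) (constant 243))) ⟩
    2 * (B * (B * (d * d * d * (r * (r * r)) * (g * g))))           ≡⟨ regroup″ B d (r * (r * r)) g ⟩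
    q * Y ∎
    where
    regroup : ∀ k r d → 2 * (k * r * (k * r * (k * r * (k * r * (k * r * (k * r * (k * d * (k * d * (k * d * 1)))))))))
              ≡ 2 * (k * k * k * k * (k * k * k * k * k) * (d * d * d * (r * (r * r)))) * (r * (r * r))
    regroup = solve-∀
    regroup′ : ∀ c e x y → 2 * (c * e * x) * (64 * y) ≡ 2 * (c * 64 * (e * (x * y)))
    regroup′ = solve-∀
    regroup″ : ∀ B d s g → 2 * (B * (B * (d * d * d * s * (g * g)))) ≡ 2 * (B * (d * g)) * (B * (d * d * (s * g)))
    regroup″ = solve-∀

  -- After cancellation the requirement is rt² = O(g), which is why `t` may not exceed the order
  -- r^(1/4).
  cherries-fit : N * (N * (d * 1)) ≤ q * (q * (q * r))
  cherries-fit = begin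
    N * (N * (d * 1))                                       ≡⟨ regroup B d r t g ⟩
    90 * 90 * (B * B * (d * d * d * (g * g) * r)) * (r * (t * t))    ≤⟨ *-monoʳ-≤ (90 * 90 * (B * B * (d * d * d * (g * g) * r))) rt²≤32g ⟩
    90 * 90 * (B * B * (d * d * d * (g * g) * r)) * (32 * g)         ≡⟨ regroup′ (90 * 90) (B * B * (d * d * d * (g * g) * r)) g ⟩
    90 * 90 * 32 * (B * B * (d * d * d * (g * g) * r) * g)  ≤⟨ *-monoˡ-≤ (B * B * (d * d * d * (g * g) * r) * g) (*-monoʳ-≤ 8 B≥) ⟩
    8 * B * (B * B * (d * d * d * (g * g) * r) * g)         ≡⟨ regroup″ B d g r ⟩
    q * (q * (q * r)) ∎
    where
    regroup : ∀ B d r t g → 90 * (B * (d * (r * (t * g)))) * (90 * (B * (d * (r * (t * g)))) * (d * 1))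
              ≡ 90 * 90 * (B * B * (d * d * d * (g * g) * r)) * (r * (t * t))
    regroup = solve-∀
    regroup′ : ∀ c x g → c * x * (32 * g) ≡ c * 32 * (x * g)
    regroup′ = solve-∀
    regroup″ : ∀ B d g r → 8 * B * (B * B * (d * d * d * (g * g) * r) * g)
               ≡ 2 * (B * (d * g)) * (2 * (B * (d * g)) * (2 * (B * (d * g)) * r))
    regroup″ = solve-∀

  N-bound : N * ℓ₂ ≤ 360 * B * (d * (r * (r * r)))
  N-bound = begin
    N * ℓ₂                                   ≤⟨ *-monoʳ-≤ N ℓ₂≤4L ⟩
    N * (4 * L)                              ≡⟨ regroup B d r t g L ⟩
    360 * B * (d * (r * (Lt * g)))           ≤⟨ *-monoʳ-≤ (360 * B) (*-monoʳ-≤ d (*-monoʳ-≤ r Ltg≤r²)) ⟩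
    360 * B * (d * (r * (r * r))) ∎
    where
    regroup : ∀ B d r t g L → 90 * (B * (d * (r * (t * g)))) * (4 * L) ≡ 360 * B * (d * (r * (L * t * g)))
    regroup = solve-∀

  bounded⇒rainbow : (χ : Coloring N) → (∀ u α → length (Colouring.nb χ u α) ≤ d) →
                      Σ (Embedding r N) λ e → Rainbow χ (proj₁ e)
  bounded⇒rainbow χ bounded = Colouring.rainbow-clique χ bounded {r} {q} {M} {t} {Y}
    (*-mono-< {0} {2} {0} (s≤s z≤n) h>0) (growth h L h>0) NM>0 determined-fits budget cherries-fit

-- 32400 = 90 · 90 · 32 / 8 is what cherries-fit requires.
abstract
  B : ℕ
  B = 32400

  B≥ : 32400 ≤ B
  B≥ = ≤-refl

  C : ℕ
  C = 360 * B

  C>0 : 0 < C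
  C>0 = s≤s z≤n

  rainbow-threshold : ∀ r d → 2 ≤ r → 0 < d → ∃[ N ] (0 < N × N * ⌊log₂ r ⌋ ≤ C * (d * (r * (r * r)))
    × ((χ : Coloring N) → (∀ u α → length (Colouring.nb χ u α) ≤ d) → Σ (Embedding r N) λ e → Rainbow χ (proj₁ e)))
  rainbow-threshold r d r≥2 d>0 = N , N>0 , N-bound , bounded⇒rainbow
    where open Budget B B≥ r r≥2 d d>0

-- Monochromatic and lexical cliques

module Cliques {n : ℕ} (χ : Coloring n) where

  open Colouring χ

  -- Although colours range over ℕ, only the colours κ u w need searching: a large neighbourhood is
  -- nonempty, so its colour is of this form.
  bounded-or-large : ∀ d → (∀ u α → length (nb u α) ≤ d) ⊎ ∃[ u ] ∃[ α ] (d < length (nb u α))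
  bounded-or-large d with any? (λ u → any? λ w → d <? length (nb u (κ u w)))
  ... | yes (u , w , d<) = inj₂ (u , κ u w , d<)
  ... | no ¬large        = inj₁ λ u α → ≮⇒≥ λ d< → case nonempty (<-≤-trans (s≤s z≤n) d<) of λ
    (w , w∈) → ¬large (u , w , subst (λ β → d < length (nb u β)) (sym (proj₂ (∈-nb⁻ w∈))) d<)
    where
    nonempty : ∀ {xs : List (Fin n)} → 0 < length xs → ∃ (_∈ˡ xs)
    nonempty {x ∷ xs} _ = x , here refl

  point : Fin n → Embedding 1 n
  point x = (λ _ → x) , λ { {zero} {zero} _ → refl }

  cons : ∀ {s} z α (e : Embedding s n) → (∀ i → proj₁ e i ∈ˡ nb z α) → Embedding (suc s) n
  cons {s} z α (f , f-inj) f∈ = f′ , f′-inj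
    where
    f′ : Fin (suc s) → Fin n
    f′ zero    = z
    f′ (suc i) = f i
    f′-inj : ∀ {i j} → f′ i ≡ f′ j → i ≡ j
    f′-inj {zero}  {zero}  _  = refl
    f′-inj {zero}  {suc j} eq = contradiction (sym eq) (proj₁ (∈-nb⁻ (f∈ j)))
    f′-inj {suc i} {zero}  eq = contradiction eq (proj₁ (∈-nb⁻ (f∈ i)))
    f′-inj {suc i} {suc j} eq = cong suc (f-inj eq)

  MonoIn Avoids : ∀ {s} → ℕ → Embedding s n → Set
  MonoIn α e = ∀ {i j} → i Fin.< j → κ (proj₁ e i) (proj₁ e j) ≡ α
  Avoids α e = ∀ {i j} → i Fin.< j → κ (proj₁ e i) (proj₁ e j) ≢ α

  monoIn⇒mono : ∀ {s α} (e : Embedding s n) → MonoIn α e → Monochromatic χ (proj₁ e)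
  monoIn⇒mono e m _ _ _ _ i<j i′<j′ = trans (m i<j) (sym (m i′<j′))

  monoIn-cons : ∀ {s z α} (e : Embedding s n) f∈ → MonoIn α e → MonoIn α (cons z α e f∈)
  monoIn-cons e f∈ m {zero}  {suc j} _         = proj₂ (∈-nb⁻ (f∈ j))
  monoIn-cons e f∈ m {suc i} {suc j} (s≤s i<j) = m i<j

  avoids-cons : ∀ {s z α β} (e : Embedding s n) f∈ → β ≢ α → Avoids α e → Avoids α (cons z β e f∈)
  avoids-cons e f∈ β≢α av {zero}  {suc j} _         = β≢α ∘ trans (sym (proj₂ (∈-nb⁻ (f∈ j))))
  avoids-cons e f∈ β≢α av {suc i} {suc j} (s≤s i<j) = av i<j

  -- The new vertex comes first in the ordering and all its edges have colour `α`; avoiding `α`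
  -- elsewhere keeps this colour apart from those of the later lower endpoints.
  lexical-cons : ∀ {s z α} (e : Embedding s n) f∈ → Lexical χ (proj₁ e) → Avoids α e →
                 Lexical χ (proj₁ (cons z α e f∈))
  lexical-cons e f∈ lex av zero (suc j) zero (suc j′) _ _ =
    mk⇔ (λ _ → refl) (λ _ → trans (proj₂ (∈-nb⁻ (f∈ j))) (sym (proj₂ (∈-nb⁻ (f∈ j′)))))
  lexical-cons e f∈ lex av zero (suc j) (suc i′) (suc j′) _ (s≤s i′<j′) =
    mk⇔ (λ eq → contradiction (trans (sym eq) (proj₂ (∈-nb⁻ (f∈ j)))) (av i′<j′)) λ ()
  lexical-cons e f∈ lex av (suc i) (suc j) zero (suc j′) (s≤s i<j) _ =
    mk⇔ (λ eq → contradiction (trans eq (proj₂ (∈-nb⁻ (f∈ j′)))) (av i<j)) λ ()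
  lexical-cons e f∈ lex av (suc i) (suc j) (suc i′) (suc j′) (s≤s i<j) (s≤s i′<j′) =
    mk⇔ (λ eq → cong suc (to eq)) (λ eq → from (Finₚ.suc-injective eq))
    where open Equivalence (lex i j i′ j′ i<j i′<j′)

  avoids-or-hits : ∀ {s} α (e : Embedding s n) → Avoids α e ⊎
    ∃[ i ] ∃[ j ] (proj₁ e i ≢ proj₁ e j × κ (proj₁ e i) (proj₁ e j) ≡ α)
  avoids-or-hits α e with any? (λ i → any? λ j → (i Fin.<? j) ×-dec (κ (proj₁ e i) (proj₁ e j) ℕ≟ α))
  ... | yes (i , j , i<j , eq) = inj₂ (i , j , Finₚ.<⇒≢ i<j ∘ proj₂ e , eq)
  ... | no ¬hit                = inj₁ λ i<j eq → ¬hit (_ , _ , i<j , eq)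

  module _ {a b : Fin n} (a≢b : a ≢ b) where

    private
      b∈ : ∀ i → proj₁ (point b) i ∈ˡ nb a (κ a b)
      b∈ _ = ∈-nb⁺ (≢-sym a≢b) refl

    edge : Embedding 2 n
    edge = cons a (κ a b) (point b) b∈

    edge-∈ : ∀ {xs} → a ∈ˡ xs → b ∈ˡ xs → ∀ i → proj₁ edge i ∈ˡ xs
    edge-∈ a∈ b∈ zero    = a∈
    edge-∈ a∈ b∈ (suc _) = b∈

    edge-mono : ∀ {α} → κ a b ≡ α → MonoIn α edge
    edge-mono refl = monoIn-cons (point b) b∈ λ { {zero} {zero} () }

    edge-avoids : ∀ {α} → κ a b ≢ α → Avoids α edge
    edge-avoids ≢α = avoids-cons (point b) b∈ ≢α λ { {zero} {zero} () }

    edge-lexical : Lexical χ (proj₁ edge)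
    edge-lexical = lexical-cons (point b) b∈ (λ { zero zero _ _ () }) λ { {zero} {zero} () }

  MonoClique LexicalClique RainbowClique : ℕ → Set
  MonoClique m    = Σ (Embedding m n) λ e → Monochromatic χ (proj₁ e)
  LexicalClique ℓ = Σ (Embedding ℓ n) λ e → Lexical χ (proj₁ e)
  RainbowClique r = Σ (Embedding r n) λ e → Rainbow χ (proj₁ e)

  mono-triangle : ∀ {z α a b} → a ∈ˡ nb z α → b ∈ˡ nb z α → a ≢ b → κ a b ≡ α → MonoClique 3
  mono-triangle {z} {α} a∈ b∈ a≢b ab≡α = e , monoIn⇒mono e (monoIn-cons (edge a≢b) f∈ (edge-mono a≢b ab≡α))
    where
    f∈ = edge-∈ a≢b a∈ b∈
    e = cons z α (edge a≢b) f∈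

  mono-K₄ : ∀ {z a b c α} → a ∈ˡ nb z α → b ∈ˡ nb z α → c ∈ˡ nb z α →
            b ∈ˡ nb a α → c ∈ˡ nb a α → b ≢ c → κ b c ≡ α → MonoClique 4
  mono-K₄ {z} {a} {b} {c} {α} za zb zc ab ac b≢c bc≡α =
    e , monoIn⇒mono e (monoIn-cons t z∈ (monoIn-cons (edge b≢c) a∈ (edge-mono b≢c bc≡α)))
    where
    a∈ = edge-∈ b≢c ab ac
    t = cons a α (edge b≢c) a∈
    z∈ : ∀ i → proj₁ t i ∈ˡ nb z α
    z∈ zero    = za
    z∈ (suc i) = edge-∈ b≢c zb zc i
    e = cons z α t z∈

  lexical-triangle : ∀ {z α a b} → a ∈ˡ nb z α → b ∈ˡ nb z α → a ≢ b → κ a b ≢ α → LexicalClique 3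
  lexical-triangle {z} {α} a∈ b∈ a≢b ab≢α =
    cons z α (edge a≢b) f∈ , lexical-cons (edge a≢b) f∈ (edge-lexical a≢b) (edge-avoids a≢b ab≢α)
    where
    f∈ = edge-∈ a≢b a∈ b∈

  lexical-K₄ : ∀ {z u a b α β} → u ∈ˡ nb z α → a ∈ˡ nb z α → b ∈ˡ nb z α → a ∈ˡ nb u β → b ∈ˡ nb u β →
               β ≢ α → a ≢ b → κ a b ≢ α → κ a b ≢ β → LexicalClique 4
  lexical-K₄ {z} {u} {a} {b} {α} {β} zu za zb ua ub β≢α a≢b ab≢α ab≢β =
    cons z α t z∈ , lexical-cons t z∈ (lexical-cons (edge a≢b) u∈ (edge-lexical a≢b) (edge-avoids a≢b ab≢β))
                                     (avoids-cons (edge a≢b) u∈ β≢α (edge-avoids a≢b ab≢α))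
    where
    u∈ = edge-∈ a≢b ua ub
    t = cons u β (edge a≢b) u∈
    z∈ : ∀ i → proj₁ t i ∈ˡ nb z α
    z∈ zero    = zu
    z∈ (suc i) = edge-∈ a≢b za zb i

module _ {n s : ℕ} (χ : Coloring n) (f : Embedding s n) where

  pullback : Coloring s
  pullback i j = edgeCol χ (proj₁ f i) (proj₁ f j)

  pullback-col : ∀ {u v} → u ≢ v → edgeCol pullback u v ≡ edgeCol χ (proj₁ f u) (proj₁ f v)
  pullback-col {u} {v} u≢v with u Fin.<? v
  ... | yes _ = refl
  ... | no _  = Colouring.κ-sym χ (≢-sym u≢v ∘ proj₂ f)

  compose : ∀ {k} → Embedding k s → Embedding k n
  compose (g , g-inj) = proj₁ f ∘ g , g-inj ∘ proj₂ f

  module _ {k : ℕ} (g : Embedding k s) where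

    compose-col : ∀ {i j} → i Fin.< j → col pullback (proj₁ g) i j ≡ col χ (proj₁ (compose g)) i j
    compose-col i<j = pullback-col (Finₚ.<⇒≢ i<j ∘ proj₂ g)

    compose-mono : Monochromatic pullback (proj₁ g) → Monochromatic χ (proj₁ (compose g))
    compose-mono m i j i′ j′ p q = trans (sym (compose-col p)) (trans (m i j i′ j′ p q) (compose-col q))

    compose-rainbow : Rainbow pullback (proj₁ g) → Rainbow χ (proj₁ (compose g))
    compose-rainbow rb i j i′ j′ p q eq = rb i j i′ j′ p q (trans (compose-col p) (trans eq (sym (compose-col q))))

    compose-lexical : Lexical pullback (proj₁ g) → Lexical χ (proj₁ (compose g))
    compose-lexical lex i j i′ j′ p q = mk⇔
      (λ eq → to (trans (compose-col p) (trans eq (sym (compose-col q)))))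
      (λ eq → trans (sym (compose-col p)) (trans (from eq) (compose-col q)))
      where open Equivalence (lex i j i′ j′ p q)

-- Bounds on ER

module _ (r : ℕ) (r≥3 : 3 ≤ r) where

  private
    r≥2 : 2 ≤ r
    r≥2 = ≤-trans (n≤1+n 2) r≥3

    ℓ₂ : ℕ
    ℓ₂ = ⌊log₂ r ⌋

  -- Among `m` vertices in the α-neighbourhood of z, either every edge has colour `α`, or an edge of
  -- another colour forms a lexical triangle with z.
  arrows-m-3 : ∀ m → 0 < m → ∃[ N ] (0 < N × N * ℓ₂ ≤ C * (m * (r * (r * r))) × Arrows N m 3 r)
  arrows-m-3 m m>0 = let N , N>0 , N≤ , rainbow = rainbow-threshold r m r≥2 m>0 in N , N>0 , N≤ , arrows rainbow
    where
    arrows : ∀ {N} → ((χ : Coloring N) → (∀ u α → length (Colouring.nb χ u α) ≤ m) →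
             Σ (Embedding r N) λ e → Rainbow χ (proj₁ e)) → Arrows N m 3 r
    arrows {N} rainbow χ with Cliques.bounded-or-large χ m
    ... | inj₁ bounded      = inj₂ (inj₂ (rainbow χ bounded))
    ... | inj₂ (z , α , m<) with embed (Colouring.nb-unique χ z α) (<⇒≤ m<)
    ... | e , e∈ with any? (λ i → any? λ j → (i Fin.<? j) ×-dec ¬? (edgeCol χ (proj₁ e i) (proj₁ e j) ℕ≟ α))
    ...   | yes (i , j , i<j , ≢α) = inj₂ (inj₁
      (Cliques.lexical-triangle χ (e∈ i) (e∈ j) (Finₚ.<⇒≢ i<j ∘ proj₂ e) ≢α))
    ...   | no ¬≢α = inj₁ (e , Cliques.monoIn⇒mono χ {α = α} e λ {i} {j} i<j →
      decidable-stable (_ ℕ≟ α) (λ ≢α → ¬≢α (i , j , i<j , ≢α)))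

  -- A lexical clique found in the α-neighbourhood of z either avoids `α`, and z extends it, or has
  -- an edge of colour `α`, which forms a monochromatic triangle with z.
  arrows-3-suc : ∀ {s ℓ N} → Arrows s 3 ℓ r → ((χ : Coloring N) → (∀ u α → length (Colouring.nb χ u α) ≤ s) →
                 Σ (Embedding r N) λ e → Rainbow χ (proj₁ e)) → Arrows N 3 (suc ℓ) r
  arrows-3-suc arr rainbow χ with Cliques.bounded-or-large χ _
  ... | inj₁ bounded      = inj₂ (inj₂ (rainbow χ bounded))
  ... | inj₂ (z , α , s<) with embed (Colouring.nb-unique χ z α) (<⇒≤ s<)
  ... | f , f∈ with arr (pullback χ f)
  ...   | inj₁ (g , mono)         = inj₁ (compose χ f g , compose-mono χ f g mono)
  ...   | inj₂ (inj₂ (g , rb))    = inj₂ (inj₂ (compose χ f g , compose-rainbow χ f g rb))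
  ...   | inj₂ (inj₁ (g , lex)) with Cliques.avoids-or-hits χ α (compose χ f g)
  ...     | inj₁ avoids = inj₂ (inj₁ (Cliques.cons χ z α (compose χ f g) (f∈ ∘ proj₁ g) ,
              Cliques.lexical-cons χ (compose χ f g) (f∈ ∘ proj₁ g) (compose-lexical χ f g lex) avoids))
  ...     | inj₂ (i , j , i≢j , hit) = inj₁ (Cliques.mono-triangle χ (f∈ (proj₁ g i)) (f∈ (proj₁ g j)) i≢j hit)

  -- The exponent suc k is ℓ - 2 for ℓ = 3 + k. The 3 in the constant comes from m = 3 in the base
  -- case and is slack in the induction step.
  arrows-3-ℓ : ∀ k → ∃[ N ] (0 < N × N * ℓ₂ ^ suc k ≤ (C * 3 * (r * (r * r))) ^ suc k × Arrows N 3 (3 + k) r)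
  arrows-3-ℓ zero = let N , N>0 , N≤ , arr = arrows-m-3 3 (s≤s z≤n) in
    N , N>0 , ≤-trans (≤-reflexive (cong (N *_) (*-identityʳ ℓ₂))) (≤-trans N≤ (≤-reflexive
      (trans (sym (*-assoc C 3 (r * (r * r)))) (sym (*-identityʳ _))))) , arr
  arrows-3-ℓ (suc k) =
    let s , s>0 , s≤ , arr = arrows-3-ℓ k
        N , N>0 , N≤ , rainbow = rainbow-threshold r s r≥2 s>0
    in N , N>0 , bound s N s≤ N≤ , arrows-3-suc arr rainbow
    where
    open ≤-Reasoning
    ρ c : ℕ
    ρ = r * (r * r)
    c = C * 3 * ρ
    regroup : ∀ a s ρ p → a * (s * ρ) * p ≡ a * ρ * (s * p)
    regroup = solve-∀
    bound : ∀ s N → s * ℓ₂ ^ suc k ≤ c ^ suc k → N * ℓ₂ ≤ C * (s * ρ) → N * (ℓ₂ * ℓ₂ ^ suc k) ≤ c * c ^ suc k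
    bound s N s≤ N≤ = begin
      N * (ℓ₂ * ℓ₂ ^ suc k)          ≡⟨ sym (*-assoc N ℓ₂ _) ⟩
      N * ℓ₂ * ℓ₂ ^ suc k            ≤⟨ *-monoˡ-≤ (ℓ₂ ^ suc k) N≤ ⟩
      C * (s * ρ) * ℓ₂ ^ suc k       ≡⟨ regroup C s ρ (ℓ₂ ^ suc k) ⟩
      C * ρ * (s * ℓ₂ ^ suc k)       ≤⟨ *-mono-≤ (*-monoˡ-≤ ρ (m≤m*n C 3)) s≤ ⟩
      c * c ^ suc k ∎

-- Colour neighbourhoods without monochromatic or lexical K₄

module Neighbourhood {n : ℕ} (χ : Coloring n) (z : Fin n) (α : ℕ) where

  open Colouring χ
  open Cliques χ
  open DecMembership (_≟_ {n}) using () renaming (_∈?_ to _∈ˡ?_)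

  T : List (Fin n)
  T = nb z α

  nbT : Fin n → ℕ → List (Fin n)
  nbT u β = filter (inNb? u β) T

  ∈-nbT⁺ : ∀ {u β w} → w ∈ˡ T → w ≢ u → κ u w ≡ β → w ∈ˡ nbT u β
  ∈-nbT⁺ {u} {β} w∈ w≢u eq = ∈-filter⁺ (inNb? u β) w∈ (w≢u , eq)

  ∈-nbT⁻ : ∀ {u β w} → w ∈ˡ nbT u β → w ∈ˡ T × w ∈ˡ nb u β
  ∈-nbT⁻ {u} {β} w∈ = let w∈T , w≢u , eq = ∈-filter⁻ (inNb? u β) {xs = T} w∈ in w∈T , ∈-nb⁺ w≢u eq

  nbT-unique : ∀ u β → Unique (nbT u β)
  nbT-unique u β = filter⁺ (inNb? u β) (nb-unique z α)

  -- `NoMono` concerns the whole graph, `NoLexical` only lexical K₄'s with first vertex `z`.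
  NoMono NoLexical : Set
  NoMono    = ∀ {u a b c β} → a ∈ˡ nb u β → b ∈ˡ nb u β → c ∈ˡ nb u β →
              b ∈ˡ nb a β → c ∈ˡ nb a β → b ≢ c → κ b c ≢ β
  NoLexical = ∀ {u a b β} → u ∈ˡ T → a ∈ˡ T → b ∈ˡ T → a ∈ˡ nb u β → b ∈ˡ nb u β →
              β ≢ α → a ≢ b → κ a b ≢ α → κ a b ≡ β

  LowDegree : ℕ → Set
  LowDegree s = ∀ {u} → u ∈ˡ T → length (nbT u α) ≤ s

  mono-K₄? : MonoClique 4 ⊎ NoMono
  mono-K₄? with any? (λ u → any? λ a → any? λ b → any? λ c → let β = κ u a in
    (a ∈ˡ? nb u β) ×-dec (b ∈ˡ? nb u β) ×-dec (c ∈ˡ? nb u β) ×-dec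
    (b ∈ˡ? nb a β) ×-dec (c ∈ˡ? nb a β) ×-dec ¬? (b ≟ c) ×-dec (κ b c ℕ≟ β))
  ... | yes (u , a , b , c , ua , ub , uc , ab , ac , b≢c , bc) = inj₁ (mono-K₄ ua ub uc ab ac b≢c bc)
  ... | no ¬mono = inj₂ no-mono
    where
    no-mono : NoMono
    no-mono ua ub uc ab ac b≢c bc with ∈-nb⁻ ua
    ... | _ , refl = ¬mono (_ , _ , _ , _ , ua , ub , uc , ab , ac , b≢c , bc)

  lexical-K₄? : LexicalClique 4 ⊎ NoLexical
  lexical-K₄? with any? (λ u → any? λ a → any? λ b → let β = κ u a in
    (u ∈ˡ? T) ×-dec (a ∈ˡ? T) ×-dec (b ∈ˡ? T) ×-dec (a ∈ˡ? nb u β) ×-dec (b ∈ˡ? nb u β) ×-dec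
    ¬? (β ℕ≟ α) ×-dec ¬? (a ≟ b) ×-dec ¬? (κ a b ℕ≟ α) ×-dec ¬? (κ a b ℕ≟ β))
  ... | yes (u , a , b , u∈ , a∈ , b∈ , ua , ub , β≢α , a≢b , ab≢α , ab≢β) =
    inj₁ (lexical-K₄ u∈ a∈ b∈ ua ub β≢α a≢b ab≢α ab≢β)
  ... | no ¬lex = inj₂ no-lexical
    where
    no-lexical : NoLexical
    no-lexical {β = β} u∈ a∈ b∈ ua ub β≢α a≢b ab≢α with ∈-nb⁻ ua
    ... | _ , refl = decidable-stable (_ ℕ≟ β) λ ab≢β →
      ¬lex (_ , _ , _ , u∈ , a∈ , b∈ , ua , ub , β≢α , a≢b , ab≢α , ab≢β)

  -- A lexical triangle in the α-neighbourhood of u within `T` either avoids `α`, and `z` extends it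
  -- to a lexical K₄, or has an α-edge, which forms a monochromatic K₄ with `z` and u.
  low-degree : ∀ {s r} → Arrows s 4 3 r → NoMono →
               (MonoClique 4 ⊎ LexicalClique 4 ⊎ RainbowClique r) ⊎ LowDegree s
  low-degree {s} arr no-mono with any? (λ u → (u ∈ˡ? T) ×-dec (s ≤? length (nbT u α)))
  ... | no ¬high = inj₂ λ {u} u∈ → <⇒≤ (≰⇒> λ s≤ → ¬high (u , u∈ , s≤))
  ... | yes (u , u∈ , s≤) with embed (nbT-unique u α) s≤
  ... | f , f∈ with arr (pullback χ f)
  ...   | inj₁ (g , mono)      = inj₁ (inj₁ (compose χ f g , compose-mono χ f g mono))
  ...   | inj₂ (inj₂ (g , rb)) = inj₁ (inj₂ (inj₂ (compose χ f g , compose-rainbow χ f g rb)))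
  ...   | inj₂ (inj₁ (g , lex)) with avoids-or-hits α (compose χ f g)
  ...     | inj₁ avoids = inj₁ (inj₂ (inj₁ (cons z α (compose χ f g) g∈ ,
              lexical-cons (compose χ f g) g∈ (compose-lexical χ f g lex) avoids)))
    where
    g∈ : ∀ i → proj₁ (compose χ f g) i ∈ˡ T
    g∈ i = proj₁ (∈-nbT⁻ (f∈ (proj₁ g i)))
  ...     | inj₂ (i , j , i≢j , hit) with ∈-nbT⁻ (f∈ (proj₁ g i)) | ∈-nbT⁻ (f∈ (proj₁ g j))
  ...       | zi , ui | zj , uj = contradiction hit (no-mono u∈ zi zj ui uj i≢j)

  module _ (no-mono : NoMono) (no-lexical : NoLexical) where

    -- R(3,3) ≤ 6 in the β-neighbourhood of u, where only the colours α and β occur.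
    degree-≤5 : ∀ {u β} → u ∈ˡ T → β ≢ α → length (nbT u β) ≤ 5
    degree-≤5 {u} {β} u∈ β≢α = go (nbT u β) (nbT-unique u β) (λ x∈ → x∈)
      where
      α-or-β : ∀ {a b} → a ∈ˡ nbT u β → b ∈ˡ nbT u β → a ≢ b → κ a b ≢ α → κ a b ≡ β
      α-or-β a∈ b∈ a≢b = no-lexical {β = β} u∈ (proj₁ (∈-nbT⁻ a∈)) (proj₁ (∈-nbT⁻ b∈))
        (proj₂ (∈-nbT⁻ a∈)) (proj₂ (∈-nbT⁻ b∈)) β≢α a≢b

      no-triangle : ∀ {y γ a b c} → a ∈ˡ nb y γ → b ∈ˡ nb y γ → c ∈ˡ nb y γ →
                    a ≢ b → a ≢ c → b ≢ c → κ a b ≡ γ → κ a c ≡ γ → κ b c ≢ γ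
      no-triangle a∈ b∈ c∈ a≢b a≢c b≢c ab ac =
        no-mono a∈ b∈ c∈ (∈-nb⁺ (≢-sym a≢b) ab) (∈-nb⁺ (≢-sym a≢c) ac) b≢c

      no-α : ∀ {a b c} → a ∈ˡ nbT u β → b ∈ˡ nbT u β → c ∈ˡ nbT u β →
             a ≢ b → a ≢ c → b ≢ c → κ a b ≡ α → κ a c ≡ α → κ b c ≢ α
      no-α a∈ b∈ c∈ = no-triangle (proj₁ (∈-nbT⁻ a∈)) (proj₁ (∈-nbT⁻ b∈)) (proj₁ (∈-nbT⁻ c∈))

      no-β : ∀ {a b c} → a ∈ˡ nbT u β → b ∈ˡ nbT u β → c ∈ˡ nbT u β →
             a ≢ b → a ≢ c → b ≢ c → κ a b ≡ β → κ a c ≡ β → κ b c ≢ β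
      no-β a∈ b∈ c∈ = no-triangle (proj₂ (∈-nbT⁻ a∈)) (proj₂ (∈-nbT⁻ b∈)) (proj₂ (∈-nbT⁻ c∈))

      at-most-2 : ∀ {P : Fin n → Set} {xs} → Unique xs → (∀ {x} → x ∈ˡ xs → P x) →
                  (∀ {a b c} → P a → P b → P c → a ≢ b → a ≢ c → b ≢ c → ⊥) → length xs ≤ 2
      at-most-2 {xs = []}            _ _ _ = z≤n
      at-most-2 {xs = _ ∷ []}        _ _ _ = s≤s z≤n
      at-most-2 {xs = _ ∷ _ ∷ []}    _ _ _ = ≤-refl
      at-most-2 {xs = a ∷ b ∷ c ∷ _} ((a≢b ∷ a≢c ∷ _) ∷ (b≢c ∷ _) ∷ _) p ¬3 =
        ⊥-elim (¬3 (p (here refl)) (p (there (here refl))) (p (there (there (here refl)))) a≢b a≢c b≢c)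

      go : ∀ xs → Unique xs → (∀ {x} → x ∈ˡ xs → x ∈ˡ nbT u β) → length xs ≤ 5
      go []       _            _   = z≤n
      go (y ∷ xs) (y∉ ∷ uniq) xs⊆ = s≤s (begin
        length xs                                          ≤⟨ length-⊆ uniq split ⟩
        length (filter isα? xs ++ filter notα? xs)         ≡⟨ length-++ (filter isα? xs) ⟩
        length (filter isα? xs) + length (filter notα? xs) ≤⟨ +-mono-≤
          (at-most-2 (filter⁺ isα? uniq) (∈-filter⁻ isα? {xs = xs}) few-α)
          (at-most-2 (filter⁺ notα? uniq) (∈-filter⁻ notα? {xs = xs}) few-β) ⟩
        4 ∎)
        where
        open ≤-Reasoning
        isα? : ∀ x → Dec (κ y x ≡ α)
        isα? x = κ y x ℕ≟ α
        notα? : ∀ x → Dec (κ y x ≢ α)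
        notα? x = ¬? (isα? x)
        split : ∀ {x} → x ∈ˡ xs → x ∈ˡ filter isα? xs ++ filter notα? xs
        split {x} x∈ with isα? x
        ... | yes p = ∈-++⁺ˡ (∈-filter⁺ isα? x∈ p)
        ... | no ¬p = ∈-++⁺ʳ (filter isα? xs) (∈-filter⁺ notα? x∈ ¬p)
        y∈ : y ∈ˡ nbT u β
        y∈ = xs⊆ (here refl)
        y≢ : ∀ {x} → x ∈ˡ xs → y ≢ x
        y≢ = All.lookup y∉
        -- Three α-neighbours of `y` span no α-edge, which would form a monochromatic K₄ with `z`
        -- and `y`. They would thus span a β-triangle, completed by `u`.
        few-α : ∀ {a b c} → a ∈ˡ xs × κ y a ≡ α → b ∈ˡ xs × κ y b ≡ α → c ∈ˡ xs × κ y c ≡ α →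
                a ≢ b → a ≢ c → b ≢ c → ⊥
        few-α (a∈ , ya) (b∈ , yb) (c∈ , yc) a≢b a≢c b≢c =
          no-β (xs⊆ (there a∈)) (xs⊆ (there b∈)) (xs⊆ (there c∈)) a≢b a≢c b≢c
            (β-edge a∈ b∈ a≢b ya yb) (β-edge a∈ c∈ a≢c ya yc) (β-edge b∈ c∈ b≢c yb yc)
          where
          β-edge : ∀ {a b} → a ∈ˡ xs → b ∈ˡ xs → a ≢ b → κ y a ≡ α → κ y b ≡ α → κ a b ≡ β
          β-edge a∈ b∈ a≢b ya yb = α-or-β (xs⊆ (there a∈)) (xs⊆ (there b∈)) a≢b
            (no-α y∈ (xs⊆ (there a∈)) (xs⊆ (there b∈)) (y≢ a∈) (y≢ b∈) a≢b ya yb)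
        few-β : ∀ {a b c} → a ∈ˡ xs × κ y a ≢ α → b ∈ˡ xs × κ y b ≢ α → c ∈ˡ xs × κ y c ≢ α →
                a ≢ b → a ≢ c → b ≢ c → ⊥
        few-β (a∈ , ya) (b∈ , yb) (c∈ , yc) a≢b a≢c b≢c =
          no-α (xs⊆ (there a∈)) (xs⊆ (there b∈)) (xs⊆ (there c∈)) a≢b a≢c b≢c
            (α-edge a∈ b∈ a≢b ya yb) (α-edge a∈ c∈ a≢c ya yc) (α-edge b∈ c∈ b≢c yb yc)
          where
          α-edge : ∀ {a b} → a ∈ˡ xs → b ∈ˡ xs → a ≢ b → κ y a ≢ α → κ y b ≢ α → κ a b ≡ α
          α-edge a∈ b∈ a≢b ya yb = decidable-stable (_ ℕ≟ α) λ ab≢α →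
            no-β y∈ (xs⊆ (there a∈)) (xs⊆ (there b∈)) (y≢ a∈) (y≢ b∈) a≢b
              (α-or-β y∈ (xs⊆ (there a∈)) (y≢ a∈) ya) (α-or-β y∈ (xs⊆ (there b∈)) (y≢ b∈) yb)
              (α-or-β (xs⊆ (there a∈)) (xs⊆ (there b∈)) a≢b ab≢α)

    -- Excluding `α` inside `S` ensures that every colour used there has degree at most 5 in `T`.
    record Rainbowα (S : List (Fin n)) : Set where
      field
        unique  : Unique S
        within  : ∀ {x} → x ∈ˡ S → x ∈ˡ T
        no-α    : ∀ {x y} → x ∈ˡ S → y ∈ˡ S → x ≢ y → κ x y ≢ α
        rainbow : RainbowSet S

    -- Emptied for β = α so that the bound 5 holds for all colours; this also covers the meaningless
    -- values κ b b that occur in `forbidden`.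
    nbT-other : Fin n → ℕ → List (Fin n)
    nbT-other u β with β ℕ≟ α
    ... | yes _ = []
    ... | no _  = nbT u β

    nbT-other-length : ∀ {u} β → u ∈ˡ T → length (nbT-other u β) ≤ 5
    nbT-other-length β u∈ with β ℕ≟ α
    ... | yes _  = z≤n
    ... | no β≢α = degree-≤5 u∈ β≢α

    ∈-nbT-other : ∀ {u β w} → β ≢ α → w ∈ˡ nbT u β → w ∈ˡ nbT-other u β
    ∈-nbT-other {β = β} β≢α w∈ with β ℕ≟ α
    ... | yes β≡α = contradiction β≡α β≢α
    ... | no _    = w∈

    -- The last part, cubic in the length of `S`, guards against colours already used in `S`; two
    -- equal colours at a new vertex are caught by it as well.
    forbidden : List (Fin n) → List (Fin n)
    forbidden S = S ++ (S >>= λ a → nbT a α) ++ (S >>= λ a → S >>= λ b → S >>= λ c → nbT-other a (κ b c))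

    forbidden-length : ∀ {s k S} → LowDegree s → Rainbowα S → length S ≤ k →
                       length (forbidden S) ≤ k + (k * s + k * (k * (k * 5)))
    forbidden-length {S = S} low good |S|≤k = ≤-trans (≤-reflexive (length-++ S)) (+-mono-≤ |S|≤k
      (≤-trans (≤-reflexive (length-++ (S >>= λ a → nbT a α))) (+-mono-≤
        (length-bind-∈ {xs = S} _ |S|≤k (low ∘ within))
        (length-bind-∈ {xs = S} _ |S|≤k λ a∈ → length-bind {xs = S} _ |S|≤k λ b → length-bind {xs = S} _ |S|≤k λ c →
          nbT-other-length (κ b c) (within a∈)))))
      where open Rainbowα good

    extend : ∀ {S v} → Rainbowα S → v ∈ˡ T → v ∉ˡ forbidden S → Rainbowα (v ∷ S)
    extend {S} {v} good v∈T v∉ = record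
      { unique  = All.tabulate (λ x∈ → ≢-sym (v≢ x∈)) ∷ unique
      ; within  = λ { (here refl) → v∈T ; (there x∈) → within x∈ }
      ; no-α    = λ { (here refl) (here refl) v≢v → contradiction refl v≢v
                    ; (here refl) (there y∈) _ → v-no-α y∈
                    ; (there x∈) (here refl) x≢v → v-no-α x∈ ∘ trans (κ-sym (≢-sym x≢v))
                    ; (there x∈) (there y∈) → no-α x∈ y∈ }
      ; rainbow = rb
      }
      where
      open Rainbowα good
      v≢ : ∀ {x} → x ∈ˡ S → x ≢ v
      v≢ x∈ refl = v∉ (∈-++⁺ˡ x∈)
      v-no-α : ∀ {x} → x ∈ˡ S → κ v x ≢ α
      v-no-α x∈ vx = v∉ (∈-++⁺ʳ S (∈-++⁺ˡ (∈-bind _ x∈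
        (∈-nbT⁺ v∈T (≢-sym (v≢ x∈)) (trans (κ-sym (v≢ x∈)) vx)))))
      v-new : ∀ {a b c} → a ∈ˡ S → b ∈ˡ S → c ∈ˡ S → b ≢ c → κ v a ≢ κ b c
      v-new a∈ b∈ c∈ b≢c eq = v∉ (∈-++⁺ʳ S (∈-++⁺ʳ (S >>= λ a → nbT a α) (∈-bind _ a∈ (∈-bind _ b∈ (∈-bind _ c∈
        (∈-nbT-other (no-α b∈ c∈ b≢c) (∈-nbT⁺ v∈T (≢-sym (v≢ a∈)) (trans (κ-sym (v≢ a∈)) eq))))))))
      -- A repeated colour at v reappears on a b by no-lexical, so v is blocked by a, a, b.
      v-proper : ∀ {a b} → a ∈ˡ S → b ∈ˡ S → κ v a ≡ κ v b → a ≡ b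
      v-proper {a} {b} a∈ b∈ eq = decidable-stable (a ≟ b) λ a≢b → v-new a∈ a∈ b∈ a≢b
        (sym (no-lexical v∈T (within a∈) (within b∈) (∈-nb⁺ (v≢ a∈) refl) (∈-nb⁺ (v≢ b∈) (sym eq))
          (v-no-α a∈) a≢b (no-α a∈ b∈ a≢b)))
      rb-v : ∀ {y z w} → y ∈ˡ S → z ∈ˡ v ∷ S → w ∈ˡ v ∷ S → z ≢ w → κ v y ≡ κ z w →
             (v ≡ z × y ≡ w) ⊎ (v ≡ w × y ≡ z)
      rb-v y∈ (here refl) (here refl) z≢w _  = contradiction refl z≢w
      rb-v y∈ (here refl) (there w∈)  z≢w eq = inj₁ (refl , v-proper y∈ w∈ eq)
      rb-v y∈ (there z∈)  (here refl) z≢w eq = inj₂ (refl , v-proper y∈ z∈ (trans eq (κ-sym z≢w)))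
      rb-v y∈ (there z∈)  (there w∈)  z≢w eq = contradiction eq (v-new y∈ z∈ w∈ z≢w)
      rb : RainbowSet (v ∷ S)
      rb (here refl) (here refl) _ _ x≢y _ _ = contradiction refl x≢y
      rb (here refl) (there y∈) z∈ w∈ _ z≢w eq = rb-v y∈ z∈ w∈ z≢w eq
      rb (there x∈) (here refl) z∈ w∈ x≢y z≢w eq with rb-v x∈ z∈ w∈ z≢w (trans (κ-sym (≢-sym x≢y)) eq)
      ... | inj₁ (p , q) = inj₂ (q , p)
      ... | inj₂ (p , q) = inj₁ (q , p)
      rb (there x∈) (there y∈) (there z∈) (there w∈) x≢y z≢w eq = rainbow x∈ y∈ z∈ w∈ x≢y z≢w eq
      rb (there x∈) (there y∈) (here refl) (here refl) _ z≢w _ = contradiction refl z≢w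
      rb (there x∈) (there y∈) (here refl) (there w∈) x≢y _ eq = contradiction (sym eq) (v-new w∈ x∈ y∈ x≢y)
      rb (there x∈) (there y∈) (there z∈) (here refl) x≢y z≢w eq =
        contradiction (trans (κ-sym (≢-sym z≢w)) (sym eq)) (v-new z∈ x∈ y∈ x≢y)

    greedy : ∀ {s r} → LowDegree s → r + (r * s + r * (r * (r * 5))) < length T →
             ∀ k → k ≤ r → ∃[ S ] (length S ≡ k × Rainbowα S)
    greedy low big zero    _   = [] , refl , record
      { unique = [] ; within = λ () ; no-α = λ () ; rainbow = λ () }
    greedy {s} {r} low big (suc k) k<r with greedy low big k (<⇒≤ k<r)
    ... | S , |S|≡k , good with any? (λ v → (v ∈ˡ? T) ×-dec ¬? (v ∈ˡ? forbidden S))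
    ...   | yes (v , v∈ , v∉) = v ∷ S , cong suc |S|≡k , extend good v∈ v∉
    ...   | no none = contradiction big (≤⇒≯ (≤-trans
      (length-⊆ (nb-unique z α) λ {v} v∈ → decidable-stable (v ∈ˡ? forbidden S) λ v∉ → none (v , v∈ , v∉))
      (forbidden-length low good (≤-trans (≤-reflexive |S|≡k) (<⇒≤ k<r)))))

  K₄-or-rainbow : ∀ {s r} → Arrows s 4 3 r → r + (r * s + r * (r * (r * 5))) < length T →
                  MonoClique 4 ⊎ LexicalClique 4 ⊎ RainbowClique r
  K₄-or-rainbow {s} {r} arr big with mono-K₄?
  ... | inj₁ mono = inj₁ mono
  ... | inj₂ no-mono with lexical-K₄? | low-degree arr no-mono
  ...   | inj₁ lex | _ = inj₂ (inj₁ lex)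
  ...   | inj₂ _ | inj₁ clique = clique
  ...   | inj₂ no-lexical | inj₂ low with greedy no-mono no-lexical low big r ≤-refl
  ...     | S , |S|≡r , good = inj₂ (inj₂ (rainbowSet⇒rainbow unique rainbow (≤-reflexive (sym |S|≡r))))
    where open Rainbowα good

-- The bound for ER(4,4,r)

arrows-4-4 : ∀ r → 3 ≤ r → ∃[ N ] (N * ⌊log₂ r ⌋ ^ 2 ≤ C * (4 * C + 6) * r ^ 7 × Arrows N 4 4 r)
arrows-4-4 r r≥3 =
  let s , _ , s≤ , arr = arrows-m-3 r r≥3 4 (s≤s z≤n)
      N , _ , N≤ , rainbow = rainbow-threshold r (d s) r≥2 (≤-trans r>0 (m≤m+n r _))
  in N , bound s N s≤ N≤ , arrows arr rainbow
  where
  r≥2 : 2 ≤ r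
  r≥2 = ≤-trans (n≤1+n 2) r≥3
  r>0 : 0 < r
  r>0 = ≤-trans (s≤s z≤n) r≥3
  ℓ₂ : ℕ
  ℓ₂ = ⌊log₂ r ⌋
  d : ℕ → ℕ
  d s = r + (r * s + r * (r * (r * 5)))
  arrows : ∀ {s N} → Arrows s 4 3 r → ((χ : Coloring N) → (∀ u α → length (Colouring.nb χ u α) ≤ d s) →
           Σ (Embedding r N) λ e → Rainbow χ (proj₁ e)) → Arrows N 4 4 r
  arrows {s} arr rainbow χ with Cliques.bounded-or-large χ (d s)
  ... | inj₁ bounded        = inj₂ (inj₂ (rainbow χ bounded))
  ... | inj₂ (z , α , big)  = Neighbourhood.K₄-or-rainbow χ z α arr big
  open ≤-Reasoning
  ρ : ℕ
  ρ = r * (r * r)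
  ℓ₂≤r : ℓ₂ ≤ r
  ℓ₂≤r = ≤-trans (n≤2^n ℓ₂) (2^log≤ r r>0)
  r*r≤r*ρ : r * r ≤ r * ρ
  r*r≤r*ρ = *-monoʳ-≤ r (m≤m*n r (r * r) {{>-nonZero (*-mono-< {0} {r} {0} r>0 r>0)}})
  -- The term r s gives the order r⁴/log r. The terms r and 5r³ are absorbed by log₂ r ≤ r and
  -- account for 6 = 1 + 5.
  d-bound : ∀ s → s * ℓ₂ ≤ C * (4 * ρ) → d s * ℓ₂ ≤ (4 * C + 6) * (r * ρ)
  d-bound s s≤ = begin
    d s * ℓ₂                                           ≡⟨ regroup r s ℓ₂ ⟩
    r * ℓ₂ + (r * (s * ℓ₂) + 5 * (ρ * ℓ₂))             ≤⟨ +-mono-≤ (≤-trans (*-monoʳ-≤ r ℓ₂≤r) r*r≤r*ρ)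
                                                            (+-mono-≤ (*-monoʳ-≤ r s≤) (*-monoʳ-≤ 5 (*-monoʳ-≤ ρ ℓ₂≤r))) ⟩
    r * ρ + (r * (C * (4 * ρ)) + 5 * (ρ * r))          ≡⟨ regroup′ r C ρ ⟩
    (4 * C + 6) * (r * ρ) ∎
    where
    regroup : ∀ r s l → (r + (r * s + r * (r * (r * 5)))) * l ≡ r * l + (r * (s * l) + 5 * (r * (r * r) * l))
    regroup = solve-∀
    regroup′ : ∀ r c ρ → r * ρ + (r * (c * (4 * ρ)) + 5 * (ρ * r)) ≡ (4 * c + 6) * (r * ρ)
    regroup′ = solve-∀
  bound : ∀ s N → s * ℓ₂ ≤ C * (4 * ρ) → N * ℓ₂ ≤ C * (d s * ρ) → N * ℓ₂ ^ 2 ≤ C * (4 * C + 6) * r ^ 7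
  bound s N s≤ N≤ = begin
    N * (ℓ₂ * (ℓ₂ * 1))                ≡⟨ regroup N ℓ₂ ⟩
    N * ℓ₂ * ℓ₂                        ≤⟨ *-monoˡ-≤ ℓ₂ N≤ ⟩
    C * (d s * ρ) * ℓ₂                 ≡⟨ regroup′ C (d s) ρ ℓ₂ ⟩
    C * (d s * ℓ₂) * ρ                 ≤⟨ *-monoˡ-≤ ρ (*-monoʳ-≤ C (d-bound s s≤)) ⟩
    C * ((4 * C + 6) * (r * ρ)) * ρ    ≡⟨ regroup″ C (4 * C + 6) r ⟩
    C * (4 * C + 6) * r ^ 7 ∎
    where
    regroup : ∀ n l → n * (l * (l * 1)) ≡ n * l * l
    regroup = solve-∀
    regroup′ : ∀ c d ρ l → c * (d * ρ) * l ≡ c * (d * l) * ρ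
    regroup′ = solve-∀
    regroup″ : ∀ c k r → c * (k * (r * (r * (r * r)))) * (r * (r * r))
               ≡ c * k * (r * (r * (r * (r * (r * (r * (r * 1)))))))
    regroup″ = solve-∀

theorem1p4 : (Σ ℕ λ c → 0 < c × (∀ m r → 3 ≤ m → 3 ≤ r →
    ER≤[ c * m * r ^ 3 / ⌊log₂ r ⌋ ] m 3 r))
    × (Σ ℕ λ c → 0 < c × (∀ ℓ r → 3 ≤ ℓ → 3 ≤ r →
    ER≤[ (c * r ^ 3) ^ (ℓ ∸ 2) / ⌊log₂ r ⌋ ^ (ℓ ∸ 2) ] 3 ℓ r))
    × (Σ ℕ λ c → 0 < c × (∀ r → 3 ≤ r →
    ER≤[ c * r ^ 7 / ⌊log₂ r ⌋ ^ 2 ] 4 4 r))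
theorem1p4 =
  (C , C>0 , part₁) , (C * 3 , *-mono-< {0} {C} {0} C>0 (s≤s z≤n) , part₂) ,
  (C * (4 * C + 6) , *-mono-< {0} {C} {0} C>0 (≤-trans (s≤s z≤n) (m≤n+m 6 (4 * C))) , part₃)
  where
  ρ≡r³ : ∀ r → r * (r * r) ≡ r ^ 3
  ρ≡r³ r = cong (λ x → r * (r * x)) (sym (*-identityʳ r))
  part₁ : ∀ m r → 3 ≤ m → 3 ≤ r → ER≤[ C * m * r ^ 3 / ⌊log₂ r ⌋ ] m 3 r
  part₁ m r m≥3 r≥3 = let N , _ , N≤ , arr = arrows-m-3 r r≥3 m (≤-trans (s≤s z≤n) m≥3) in
    N , arr , ≤-trans N≤ (≤-reflexive (trans (sym (*-assoc C m _)) (cong (C * m *_) (ρ≡r³ r))))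
  part₂ : ∀ ℓ r → 3 ≤ ℓ → 3 ≤ r → ER≤[ (C * 3 * r ^ 3) ^ (ℓ ∸ 2) / ⌊log₂ r ⌋ ^ (ℓ ∸ 2) ] 3 ℓ r
  part₂ (suc (suc (suc k))) r (s≤s (s≤s (s≤s _))) r≥3 = let N , _ , N≤ , arr = arrows-3-ℓ r r≥3 k in
    N , arr , ≤-trans N≤ (≤-reflexive (cong (λ x → (C * 3 * x) ^ suc k) (ρ≡r³ r)))
  part₃ : ∀ r → 3 ≤ r → ER≤[ C * (4 * C + 6) * r ^ 7 / ⌊log₂ r ⌋ ^ 2 ] 4 4 r
  part₃ r r≥3 = let N , N≤ , arr = arrows-4-4 r r≥3 in N , arr , N≤
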